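{- Let $R$ be a finite chain ring of length $2$ with residue field $\mathbb{F}_q$. Then there exists a projective $(q^4-q^2-q,\,q^2-1)$-arc in $\mathrm{PHG}(2,R)$; equivalently, $\mathrm{m}_{q^2-1}(R)\geq q(q+1)(q^2-1)-q^3=q^4-q^2-q$.
   Context: Throughout, $R$ is a finite chain ring of nilpotency index (length) $2$, i.e. a finite local ring with radical $\mathrm{rad}R\neq 0$, $(\mathrm{rad}R)^2=0$, whose one-sided ideals form the chain $R\supsetneq\mathrm{rad}R\supsetneq 0$, with residue field $R/\mathrm{rad}R\cong\mathbb{F}_q$ ($q$ a prime power); then $|R|=q^2$. The projective Hjelmslev plane $\mathrm{PHG}(2,R)$ is the incidence structure whose points are the free rank-$1$ submodules of the right module $R_R^3$, whose lines are the free rank-$2$ submodules of $R_R^3$, with incidence given by inclusion; it has $q^4+q^3+q^2$ points and each line contains $q^2+q$ points. A $(k,n)$-arc is a map $\mathcal{K}$ from the point set to $\mathbb{N}_0$ with $\sum_x\mathcal{K}(x)=k$ and $\sum_{x\in L}\mathcal{K}(x)\le n$ for every line $L$; it is projective if $\mathcal{K}$ takes only values in $\{0,1\}$ (i.e. it is a set of $k$ points meeting every line in at most $n$ points). For $0\le n\le q^2+q$, $\mathrm{m}_n(R)$ denotes the largest $k$ such that a projective $(k,n)$-arc exists in $\mathrm{PHG}(2,R)$. -}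

module Defs where

open import Algebra.Apartness.Bundles using (HeytingField; HeytingCommutativeRing)
open import Algebra.Bundles using (Ring; CommutativeRing; RawRing)
import Algebra.Construct.Flip.Op as Op
import Algebra.Definitions.RawMonoid as RawMonoidDefinitions
open import Algebra.Module.Bundles using (RightModule)
import Algebra.Module.Construct.DirectProduct as DirectProduct
import Algebra.Module.Construct.TensorUnit as TensorUnit
open import Algebra.Morphism.Structures using (IsRingIsomorphism)
open import Data.Fin.Base using (Fin)
open import Data.List.Base using (List; map)
import Data.List.Relation.Unary.Enumerates.Setoid as Enumerates
import Data.List.Relation.Unary.Unique.Setoid as UniqueSetoid
open import Data.Nat.Base using (ℕ; suc; _^_; _≤_)
open import Data.Nat.ListAction using (sum)
open import Data.Nat.Primality using (Prime)
open import Data.Product.Base using (Σ; ∃; ∃₂; ∃-syntax; _×_; _,_; proj₁)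
open import Data.Sum.Base using (_⊎_)
open import Function.Bundles using (Func; Inverse; _⟶ₛ_)
open import Level using (Level; _⊔_) renaming (suc to lsuc)
open import Relation.Binary.Bundles using (Setoid)
import Relation.Binary.Construct.On as On
open import Relation.Binary.PropositionalEquality.Core using (_≡_)
open import Relation.Binary.PropositionalEquality.Properties using (setoid)
open import Relation.Unary using (Pred; Decidable; U; _∈_; _⊆_; _⊂_; _≐_)
open import Relation.Unary.Properties using (≐-refl; ≐-sym; ≐-trans)

private
  variable
    a c ℓ m ℓm f ℓ₁ ℓ₂ : Level

HasSize : Setoid a ℓ → ℕ → Set (a ⊔ ℓ)
HasSize S n = Inverse S (setoid (Fin n))

Finite : Setoid a ℓ → Set (a ⊔ ℓ)
Finite S = ∃[ n ] HasSize S n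

-- SumsTo S g s : the setoid S is finite and the sum of g over its elements,
-- each counted once up to the equality of S, is s.
SumsTo : (S : Setoid a ℓ) → S ⟶ₛ setoid ℕ → ℕ → Set (a ⊔ ℓ)
SumsTo S g s = Σ (List (Setoid.Carrier S)) λ xs →
  Enumerates.IsEnumeration S xs × UniqueSetoid.Unique S xs × sum (map (Func.to g) xs) ≡ s

IsPrimePower : ℕ → Set
IsPrimePower q = ∃₂ λ p e → Prime p × q ≡ p ^ suc e

-- Over a finite setoid a Heyting field is a field in the classical sense, its
-- apartness being x ≉ y.  So this says that F is the field 𝔽_q.
record IsGaloisField (F : HeytingField f ℓ₁ ℓ₂) (q : ℕ) : Set (f ⊔ ℓ₁) where
  ring : CommutativeRing f ℓ₁
  ring = HeytingCommutativeRing.commutativeRing (HeytingField.heytingCommutativeRing F)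

  field
    primePower : IsPrimePower q
    size       : HasSize (CommutativeRing.setoid ring) q

-- A submodule is given by a decidable predicate: over a finite module these are
-- exactly the subsets.  (Ranging over undecidable predicates would make "every
-- ideal is 0, rad R or R" fail constructively for every ring.)
record Submodule {R : Ring c ℓ} (M : RightModule R m ℓm) : Set (lsuc (c ⊔ ℓ ⊔ m ⊔ ℓm)) where
  open RightModule M
  field
    mem     : Pred Carrierᴹ (c ⊔ ℓ ⊔ m ⊔ ℓm)
    mem?    : Decidable mem
    resp    : ∀ {x y} → x ≈ᴹ y → x ∈ mem → y ∈ mem
    0∈      : 0ᴹ ∈ mem
    +-closed : ∀ {x y} → x ∈ mem → y ∈ mem → (x +ᴹ y) ∈ mem
    *-closed : ∀ {x} r → x ∈ mem → (x *ᵣ r) ∈ mem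

open Submodule public using (mem)

module _ {R : Ring c ℓ} {M : RightModule R m ℓm} where
  open Ring R using (Carrier; _≈_; 0#)
  open RightModule M

  combination : ∀ {k} → (Fin k → Carrierᴹ) → (Fin k → Carrier) → Carrierᴹ
  combination b r = RawMonoidDefinitions.sum +ᴹ-rawMonoid (λ i → b i *ᵣ r i)

  record IsBasis {k} (N : Submodule M) (b : Fin k → Carrierᴹ) : Set (c ⊔ ℓ ⊔ m ⊔ ℓm) where
    field
      inside      : ∀ i → b i ∈ mem N
      spanning    : ∀ {x} → x ∈ mem N → ∃[ r ] x ≈ᴹ combination b r
      independent : ∀ r → combination b r ≈ᴹ 0ᴹ → ∀ i → r i ≈ 0#

  IsFreeOfRank : ℕ → Submodule M → Set (c ⊔ ℓ ⊔ m ⊔ ℓm)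
  IsFreeOfRank k N = Σ (Fin k → Carrierᴹ) (IsBasis N)

RightIdeal : Ring c ℓ → Set (lsuc (c ⊔ ℓ))
RightIdeal R = Submodule (TensorUnit.rightModule {R = R})

LeftIdeal : Ring c ℓ → Set (lsuc (c ⊔ ℓ))
LeftIdeal R = RightIdeal (Op.ring R)

module _ (R : Ring c ℓ) where
  open Ring R hiding (setoid)

  zeroIdeal : Pred Carrier ℓ
  zeroIdeal x = x ≈ 0#

  record IsMaximal (I : RightIdeal R) : Set (lsuc (c ⊔ ℓ)) where
    field
      proper  : mem I ⊂ U
      maximal : ∀ (J : RightIdeal R) → mem I ⊆ mem J → mem J ≐ mem I ⊎ mem J ≐ U

  rad : Pred Carrier (lsuc (c ⊔ ℓ))
  rad x = ∀ (I : RightIdeal R) → IsMaximal I → x ∈ mem I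

  IsLocal : Set (lsuc (c ⊔ ℓ))
  IsLocal = Σ (RightIdeal R) λ I →
    IsMaximal I × (∀ (J : RightIdeal R) → IsMaximal J → mem J ≐ mem I)

  -- R / rad R : the carrier and operations of R, with equality modulo rad R.
  residueRing : RawRing c (lsuc (c ⊔ ℓ))
  residueRing = record
    { Carrier = Carrier
    ; _≈_ = λ x y → x - y ∈ rad
    ; _+_ = _+_
    ; _*_ = _*_
    ; -_  = -_
    ; 0#  = 0#
    ; 1#  = 1#
    }

  record IsFiniteChainRingOfLength2 : Set (lsuc (c ⊔ ℓ)) where
    field
      finite     : Finite (Ring.setoid R)
      local      : IsLocal
      0⊂rad      : zeroIdeal ⊂ rad
      rad⊂R      : rad ⊂ U
      rad²≈0     : ∀ {x y} → x ∈ rad → y ∈ rad → x * y ≈ 0#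
      rightChain : ∀ (I : RightIdeal R) → mem I ≐ zeroIdeal ⊎ mem I ≐ rad ⊎ mem I ≐ U
      leftChain  : ∀ (I : LeftIdeal R) → mem I ≐ zeroIdeal ⊎ mem I ≐ rad ⊎ mem I ≐ U

  HasResidueField : HeytingField f ℓ₁ ℓ₂ → Set (lsuc (c ⊔ ℓ) ⊔ f ⊔ ℓ₁)
  HasResidueField F =
    ∃[ φ ] IsRingIsomorphism residueRing (CommutativeRing.rawRing commutativeRing) φ
    where open HeytingCommutativeRing (HeytingField.heytingCommutativeRing F) using (commutativeRing)

-- PHG(2,R), the right projective Hjelmslev plane.
module PHG (R : Ring c ℓ) where

  R³ : RightModule R c ℓ
  R³ = DirectProduct.rightModule R¹ (DirectProduct.rightModule R¹ R¹)
    where R¹ = TensorUnit.rightModule {R = R}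

  Point : Set (lsuc (c ⊔ ℓ))
  Point = Σ (Submodule R³) (IsFreeOfRank 1)

  Line : Set (lsuc (c ⊔ ℓ))
  Line = Σ (Submodule R³) (IsFreeOfRank 2)

  _on_ : Point → Line → Set (c ⊔ ℓ)
  (x , _) on (L , _) = mem x ⊆ mem L

  -- Points are equal when they are so as sets of vectors: the choice of a basis
  -- and the proofs of membership are irrelevant.
  points : Setoid (lsuc (c ⊔ ℓ)) (c ⊔ ℓ)
  points = record
    { Carrier = Point
    ; _≈_ = λ (x , _) (y , _) → mem x ≐ mem y
    ; isEquivalence = record { refl = ≐-refl ; sym = ≐-sym ; trans = ≐-trans }
    }

  pointsOn : Line → Setoid (lsuc (c ⊔ ℓ)) (c ⊔ ℓ)
  pointsOn L = On.setoid {B = Σ Point (_on L)} points proj₁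

  restrict : points ⟶ₛ setoid ℕ → (L : Line) → pointsOn L ⟶ₛ setoid ℕ
  restrict 𝒦 L = record { to = λ x → Func.to 𝒦 (proj₁ x) ; cong = Func.cong 𝒦 }

  record IsArc (k n : ℕ) (𝒦 : points ⟶ₛ setoid ℕ) : Set (lsuc (c ⊔ ℓ)) where
    field
      total : SumsTo points 𝒦 k
      lines : ∀ (L : Line) → ∃[ s ] SumsTo (pointsOn L) (restrict 𝒦 L) s × s ≤ n

  IsProjective : points ⟶ₛ setoid ℕ → Set (lsuc (c ⊔ ℓ))
  IsProjective 𝒦 = ∀ x → Func.to 𝒦 x ≡ 0 ⊎ Func.to 𝒦 x ≡ 1

  ProjectiveArc : (k n : ℕ) → Set (lsuc (c ⊔ ℓ))
  ProjectiveArc k n = ∃[ 𝒦 ] IsArc k n 𝒦 × IsProjective 𝒦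

  -- Is-m n k : k is the value m_n(R).
  record Is-m (n k : ℕ) : Set (lsuc (c ⊔ ℓ)) where
    field
      attained : ProjectiveArc k n
      largest  : ∀ k′ → ProjectiveArc k′ n → k′ ≤ k

{-# OPTIONS --safe #-}

-- A line has at most q² + q points, so it suffices to find a set B of at most
-- (q + 1)(q² + q) points that meets every line in at least q + 1 points: then any
-- q⁴ - q² - q points outside B form the arc.
--
-- B is the union of q + 1 disjoint pseudolines 𝓛.  Each lies over one of q + 1 lines
-- of the residue plane PG(2,q), namely x = cz (c ≠ 0), y = 0 and y = z, and consists
-- of one segment (intersection of a line with a neighbour class of points) over each
-- point of that line.  A segment has the direction of its own residue line, except
-- where several of the q + 1 lines cross: there all segments are parallel, and their
-- direction is x = z at (0:1:0) and (1:1:1), y = z at (1:0:0) and at the other (c:1:1),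
-- and y = 0 at (c:0:1).
--
-- A line meets every segment that it reaches in another direction in exactly one
-- point.  Hence lines over a residue line other than x = z, y = 0, y = z meet every
-- pseudoline; for x = cz, c ≠ 1, because it imposes its direction at no crossing.
-- Each of x = z, y = 0, y = z fails to impose its direction at exactly one crossing.
-- The segments in its direction are placed so that every line over it contains a whole
-- segment, of q points, and the crossing supplies one more point.
module Submission where

open import Defs
open import Algebra.Apartness.Bundles using (HeytingField; HeytingCommutativeRing)
open import Algebra.Bundles using (Ring)
open import Algebra.Module.Bundles using (RightModule)
open import Algebra.Morphism.Structures using (IsRingIsomorphism)
import Algebra.Properties.Ring as RingProperties
open import Data.Bool.Base using (if_then_else_; true; false)
open import Data.Empty using (⊥; ⊥-elim)
open import Data.Fin.Base using (Fin; zero; suc)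
import Data.Fin.Properties as Fin
open import Data.List.Base using (List; []; _∷_; _++_; map; filter; length; lookup; tabulate; take)
import Data.List.Membership.DecSetoid as DecMembership
import Data.List.Membership.Setoid as Membership
import Data.List.Membership.Setoid.Properties as ∈
import Data.List.Properties as List
import Data.List.Relation.Unary.All as All
open import Data.List.Relation.Unary.AllPairs using (_∷_)
open import Data.List.Relation.Unary.Any using (here; there)
import Data.List.Relation.Unary.Enumerates.Setoid as Enumerates
import Data.List.Relation.Unary.Unique.Setoid as UniqueSetoid
import Data.List.Relation.Unary.Unique.Setoid.Properties as Unique
open import Data.Nat.Base using (ℕ; suc)
open import Data.Nat.ListAction using (sum)
open import Data.Nat.ListAction.Properties using (sum-++)
import Data.Nat.Properties as ℕ
open import Data.Nat.Tactic.RingSolver using (solve-∀)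
open import Data.Product.Base using (Σ; ∃; _×_; _,_; proj₁; proj₂)
open import Data.Product.Function.NonDependent.Propositional using (_×-↔_)
open import Data.Sum.Base using (_⊎_; inj₁; inj₂)
open import Data.Sum.Function.Propositional using (_⊎-↔_)
open import Function.Base using (_∘_)
open import Function.Bundles using (Func; Injection; Inverse; _↔_; _⟶ₛ_)
open import Function.Construct.Composition using (_↔-∘_)
open import Function.Construct.Identity using (↔-id)
open import Function.Properties.Inverse using (↔⇒↣)
open import Level using (Level; _⊔_) renaming (suc to lsuc)
open import Relation.Binary.Bundles using (Setoid; DecSetoid)
import Relation.Binary.Construct.On as On
open import Relation.Binary.Definitions using (_Respects_) renaming (Decidable to Decidable₂)
import Relation.Binary.PropositionalEquality as ≡
open import Relation.Binary.PropositionalEquality.Core using (_≡_; _≢_)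
import Relation.Binary.Reasoning.Setoid as SetoidReasoning
open import Relation.Nullary using (¬_; Dec; yes; no; does)
import Relation.Nullary.Decidable as Dec
open import Relation.Unary using (Pred; Decidable; _⊆_)

private
  variable
    c ℓ f ℓ₁ ℓ₂ : Level

-- Chain rings of length 2

-- ρ is the reduction modulo rad R, T a section of it and θ a generator of rad R.
record Chain (R : Ring c ℓ) (q : ℕ) : Set (c ⊔ ℓ) where
  open Ring R
  field
    finite  : Finite setoid
    ρ       : Carrier → Fin q
    ρ-cong  : ∀ {x y} → x ≈ y → ρ x ≡ ρ y
    ρ-+     : ∀ {x x′ y y′} → ρ x ≡ ρ x′ → ρ y ≡ ρ y′ → ρ (x + y) ≡ ρ (x′ + y′)
    ρ-*     : ∀ {x x′ y y′} → ρ x ≡ ρ x′ → ρ y ≡ ρ y′ → ρ (x * y) ≡ ρ (x′ * y′)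
    T       : Fin q → Carrier
    ρ-T     : ∀ c → ρ (T c) ≡ c
    T-1     : T (ρ 1#) ≈ 1#
    θ       : Carrier
    θ≉0     : ¬ θ ≈ 0#
    θ∈rad   : ρ θ ≡ ρ 0#
    rad*rad : ∀ {x y} → ρ x ≡ ρ 0# → ρ y ≡ ρ 0# → x * y ≈ 0#
    rad⊆θR  : ∀ {x} → ρ x ≡ ρ 0# → ∃ λ t → x ≈ θ * t
    unit    : ∀ x → ρ x ≢ ρ 0# → ∃ λ y → x * y ≈ 1# × y * x ≈ 1#

-- Deciding equality and existence over a finite setoid.

module FiniteSetoid {S : Setoid c ℓ} (fin : Finite S) where
  open Setoid S
  open Inverse (proj₂ fin) using (to; from; to-cong; from-cong; strictlyInverseʳ)

  infix 4 _≈?_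

  from-to : ∀ x → from (to x) ≈ x
  from-to = strictlyInverseʳ

  _≈?_ : Decidable₂ _≈_
  x ≈? y = Dec.map′ (λ e → trans (sym (from-to x)) (trans (from-cong e) (from-to y)))
             to-cong (to x Fin.≟ to y)

  search : {P : Pred Carrier ℓ₁} → P Respects _≈_ → Decidable P → Dec (∃ P)
  search resp P? = Dec.map′ (λ (i , pi) → from i , pi)
    (λ (x , px) → to x , resp (sym (from-to x)) px) (Fin.any? (P? ∘ from))

-- Residues, inverses and a generator of the radical from the axioms of a chain ring.

module _ (R : Ring c ℓ) (F : HeytingField f ℓ₁ ℓ₂) (q : ℕ)
         (chain : IsFiniteChainRingOfLength2 R) (galois : IsGaloisField F q)
         (residue : HasResidueField R F) where
  open Ring R
  open RingProperties R
  open IsFiniteChainRingOfLength2 chain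
  open FiniteSetoid finite
  private
    module F = HeytingCommutativeRing (HeytingField.heytingCommutativeRing F)
    module 𝔪 = Submodule (proj₁ local)
    φ = proj₁ residue
    open IsRingIsomorphism (proj₂ residue) using (+-homo; *-homo; injective; surjective; ⟦⟧-cong)
    open Inverse (IsGaloisField.size galois) using (to; from; to-cong; from-cong; strictlyInverseʳ; strictlyInverseˡ)

    -- `rad` quantifies over all maximal right ideals. The unique one, 𝔪, is the same set with
    -- decidable membership, so the arguments below run in 𝔪.
    rad⊆𝔪 : rad R ⊆ mem (proj₁ local)
    rad⊆𝔪 x∈rad = x∈rad (proj₁ local) (proj₁ (proj₂ local))

    𝔪⊆rad : mem (proj₁ local) ⊆ rad R
    𝔪⊆rad x∈𝔪 I I-max = proj₂ (proj₂ (proj₂ local) I I-max) x∈𝔪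

    principal : Carrier → RightIdeal R
    principal x = record
      { mem = λ y → ∃ λ r → y ≈ x * r
      ; mem? = λ y → search (λ e y≈ → trans y≈ (*-congˡ e)) (λ r → y ≈? x * r)
      ; resp = λ e (r , y≈) → r , trans (sym e) y≈
      ; 0∈ = 0# , sym (zeroʳ x)
      ; +-closed = λ (r , y≈) (s , z≈) → r + s , trans (+-cong y≈ z≈) (sym (distribˡ x r s))
      ; *-closed = λ s (r , y≈) → r * s , trans (*-congʳ y≈) (*-assoc x r s)
      }

    self∈ : ∀ x → mem (principal x) x
    self∈ x = 1# , sym (*-identityʳ x)

    1∉𝔪 : ¬ mem (proj₁ local) 1#
    1∉𝔪 1∈ = proj₂ rad⊂R λ {x} _ → 𝔪⊆rad (𝔪.resp (*-identityˡ x) (𝔪.*-closed x 1∈))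

    -- The chain condition leaves 0, rad R and R for xR. Since x lies in xR but not in 𝔪, only R
    -- remains.
    rightInverse : ∀ x → ¬ mem (proj₁ local) x → ∃ λ y → x * y ≈ 1#
    rightInverse x x∉𝔪 with rightChain (principal x)
    ... | inj₁ e = ⊥-elim (x∉𝔪 (𝔪.resp (sym (proj₁ e (self∈ x))) 𝔪.0∈))
    ... | inj₂ (inj₁ e) = ⊥-elim (x∉𝔪 (rad⊆𝔪 (proj₁ e (self∈ x))))
    ... | inj₂ (inj₂ e) = let y , 1≈ = proj₂ e {1#} _ in y , sym 1≈

    -- A product rx outside 𝔪 would have a right inverse s. Then x = x(rxs) = (xr)xs, and (xr)x
    -- vanishes as a product of two radical elements, so x = 0 and rx = 0 would lie in 𝔪 after all.
    𝔪-*ˡ : ∀ r {x} → mem (proj₁ local) x → mem (proj₁ local) (r * x)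
    𝔪-*ˡ r {x} x∈ with 𝔪.mem? (r * x)
    ... | yes rx∈ = rx∈
    ... | no rx∉ = ⊥-elim (rx∉ (𝔪.resp (sym (trans (*-congˡ x≈0) (zeroʳ r))) 𝔪.0∈))
      where
      s = proj₁ (rightInverse (r * x) rx∉)
      x≈0 : x ≈ 0#
      x≈0 = begin
        x                  ≈⟨ *-identityʳ x ⟨
        x * 1#             ≈⟨ *-congˡ (proj₂ (rightInverse (r * x) rx∉)) ⟨
        x * (r * x * s)    ≈⟨ *-assoc x (r * x) s ⟨
        x * (r * x) * s    ≈⟨ *-congʳ (*-assoc x r x) ⟨
        (x * r) * x * s    ≈⟨ *-congʳ (rad²≈0 (𝔪⊆rad (𝔪.*-closed r x∈)) (𝔪⊆rad x∈)) ⟩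
        0# * s             ≈⟨ zeroˡ s ⟩
        0#                 ∎
        where open import Relation.Binary.Reasoning.Setoid setoid

    -- The right inverse y is itself outside 𝔪, because 𝔪 absorbs left multiplication. So y has a
    -- right inverse as well, and that one must be x.
    inverse : ∀ x → ¬ mem (proj₁ local) x → ∃ λ y → x * y ≈ 1# × y * x ≈ 1#
    inverse x x∉ = y , xy≈1 , trans (*-congˡ x≈y′) yy′≈1
      where
      y = proj₁ (rightInverse x x∉)
      xy≈1 = proj₂ (rightInverse x x∉)
      y∉ : ¬ mem (proj₁ local) y
      y∉ y∈ = 1∉𝔪 (𝔪.resp xy≈1 (𝔪-*ˡ x y∈))
      y′ = proj₁ (rightInverse y y∉)
      yy′≈1 = proj₂ (rightInverse y y∉)
      x≈y′ : x ≈ y′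
      x≈y′ = begin
        x            ≈⟨ *-identityʳ x ⟨
        x * 1#       ≈⟨ *-congˡ yy′≈1 ⟨
        x * (y * y′) ≈⟨ *-assoc x y y′ ⟨
        x * y * y′   ≈⟨ *-congʳ xy≈1 ⟩
        1# * y′      ≈⟨ *-identityˡ y′ ⟩
        y′           ∎
        where open import Relation.Binary.Reasoning.Setoid setoid

    generator : ∃ λ x → mem (proj₁ local) x × ¬ x ≈ 0#
    generator with search {P = λ x → mem (proj₁ local) x × ¬ x ≈ 0#}
                     (λ e (x∈ , x≉0) → 𝔪.resp e x∈ , λ y≈0 → x≉0 (trans e y≈0))
                     (λ x → 𝔪.mem? x Dec.×-dec Dec.¬? (x ≈? 0#))
    ... | yes found = found
    ... | no none = ⊥-elim (proj₂ 0⊂rad λ {x} x∈ →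
            Dec.decidable-stable (x ≈? 0#) λ x≉0 → none (x , rad⊆𝔪 x∈ , x≉0))

    -- The right ideal of the generator is nonzero and contained in 𝔪, so the chain condition makes
    -- it rad R.
    generates : ∀ {x} → mem (proj₁ local) x → ∃ λ t → x ≈ proj₁ generator * t
    generates x∈ with rightChain (principal (proj₁ generator))
    ... | inj₁ e = ⊥-elim (proj₂ (proj₂ generator) (proj₁ e (self∈ _)))
    ... | inj₂ (inj₁ e) = proj₂ e (𝔪⊆rad x∈)
    ... | inj₂ (inj₂ e) = let t , 1≈ = proj₂ e {1#} _ in
            ⊥-elim (1∉𝔪 (𝔪.resp (sym 1≈) (𝔪.*-closed t (proj₁ (proj₂ generator)))))

    ρ : Carrier → Fin q
    ρ x = to (φ x)

    ρ≡⇒φ≈ : ∀ {x y} → ρ x ≡ ρ y → φ x F.≈ φ y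
    ρ≡⇒φ≈ e = F.trans (F.sym (strictlyInverseʳ _)) (F.trans (from-cong e) (strictlyInverseʳ _))

    𝔪⇒ρ≡ : ∀ {x y} → mem (proj₁ local) (x - y) → ρ x ≡ ρ y
    𝔪⇒ρ≡ d∈ = to-cong (⟦⟧-cong (𝔪⊆rad d∈))

    x-0≈x : ∀ x → x - 0# ≈ x
    x-0≈x x = trans (+-congˡ -0#≈0#) (+-identityʳ x)

    ρ0⇒𝔪 : ∀ {x} → ρ x ≡ ρ 0# → mem (proj₁ local) x
    ρ0⇒𝔪 {x} e = 𝔪.resp (x-0≈x x) (rad⊆𝔪 (injective (ρ≡⇒φ≈ e)))

    𝔪⇒ρ0 : ∀ {x} → mem (proj₁ local) x → ρ x ≡ ρ 0#
    𝔪⇒ρ0 {x} x∈ = 𝔪⇒ρ≡ (𝔪.resp (sym (x-0≈x x)) x∈)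

    -- Equality in `residueRing` is a difference lying in rad R, so equality in R first becomes the
    -- difference 0.
    ρ-resp : ∀ {x y} → x ≈ y → ρ x ≡ ρ y
    ρ-resp {x} {y} x≈y = 𝔪⇒ρ≡ (𝔪.resp (sym (trans (+-congʳ x≈y) (-‿inverseʳ y))) 𝔪.0∈)

    lift : Fin q → Carrier
    lift i = proj₁ (surjective (from i))

    ρ-lift : ∀ i → ρ (lift i) ≡ i
    ρ-lift i = ≡.trans (to-cong (proj₂ (surjective (from i)) (⟦refl⟧ _))) (strictlyInverseˡ i)
      where
      ⟦refl⟧ : ∀ x → rad R (x - x)
      ⟦refl⟧ x = 𝔪⊆rad (𝔪.resp (sym (-‿inverseʳ x)) 𝔪.0∈)

    -- The lift of the residue 1 is replaced by 1 itself. This makes `j 𝟏` equal to θ and lets x = 1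
    -- be recognised as `T 𝟏` without a radical correction.
    T : Fin q → Carrier
    T i with i Fin.≟ ρ 1#
    ... | yes _ = 1#
    ... | no _  = lift i

    ρ-T : ∀ i → ρ (T i) ≡ i
    ρ-T i with i Fin.≟ ρ 1#
    ... | yes e = ≡.sym e
    ... | no _  = ρ-lift i

    T-1 : T (ρ 1#) ≈ 1#
    T-1 with ρ 1# Fin.≟ ρ 1#
    ... | yes _ = refl
    ... | no ≢  = ⊥-elim (≢ ≡.refl)

  toChain : Chain R q
  toChain = record
    { finite = finite
    ; ρ = ρ
    ; ρ-cong = ρ-resp
    -- `Fin q` carries no operations here; that ρ is a homomorphism is kept as a congruence on
    -- residues.
    ; ρ-+ = λ e e′ → to-cong (F.trans (+-homo _ _) (F.trans (F.+-cong (ρ≡⇒φ≈ e) (ρ≡⇒φ≈ e′)) (F.sym (+-homo _ _))))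
    ; ρ-* = λ e e′ → to-cong (F.trans (*-homo _ _) (F.trans (F.*-cong (ρ≡⇒φ≈ e) (ρ≡⇒φ≈ e′)) (F.sym (*-homo _ _))))
    ; T = T
    ; ρ-T = ρ-T
    ; T-1 = T-1
    ; θ = proj₁ generator
    ; θ≉0 = proj₂ (proj₂ generator)
    ; θ∈rad = 𝔪⇒ρ0 (proj₁ (proj₂ generator))
    ; rad*rad = λ x∈ y∈ → rad²≈0 (𝔪⊆rad (ρ0⇒𝔪 x∈)) (𝔪⊆rad (ρ0⇒𝔪 y∈))
    ; rad⊆θR = λ x∈ → generates (ρ0⇒𝔪 x∈)
    ; unit = λ x x∉ → inverse x (λ x∈ → x∉ (𝔪⇒ρ0 x∈))
    }

-- Arithmetic modulo the radical and two-digit expansions.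

module Residues {R : Ring c ℓ} {q : ℕ} (chain : Chain R q) where
  open Ring R
  open RingProperties R
  open Chain chain
  open FiniteSetoid finite public
  open SetoidReasoning setoid

  𝟎 𝟏 : Fin q
  𝟎 = ρ 0#
  𝟏 = ρ 1#

  Rad : Carrier → Set
  Rad x = ρ x ≡ 𝟎

  -- A numbering of the radical by residues: every radical element is some θt, and θt depends only
  -- on the residue of t.
  j : Fin q → Carrier
  j d = θ * T d

  Rad-* : ∀ {x} y → Rad x → Rad (x * y)
  Rad-* y x∈ = ≡.trans (ρ-* x∈ ≡.refl) (ρ-cong (zeroˡ y))

  Rad-+ : ∀ {x y} → Rad x → Rad y → Rad (x + y)
  Rad-+ x∈ y∈ = ≡.trans (ρ-+ x∈ y∈) (ρ-cong (+-identityˡ 0#))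

  Rad-neg : ∀ {x} → Rad x → Rad (- x)
  Rad-neg {x} x∈ = ≡.trans (ρ-cong (sym (-1*x≈-x x))) (≡.trans (ρ-* {x = - 1#} ≡.refl x∈) (ρ-cong (zeroʳ _)))

  Rad-*ˡ : ∀ {x} y → Rad x → Rad (y * x)
  Rad-*ˡ y x∈ = ≡.trans (ρ-* {x = y} ≡.refl x∈) (ρ-cong (zeroʳ y))

  Rad-j : ∀ d → Rad (j d)
  Rad-j d = Rad-* (T d) θ∈rad

  ρ-+-radˡ : ∀ {x} y → Rad x → ρ (x + y) ≡ ρ y
  ρ-+-radˡ y x∈ = ≡.trans (ρ-+ {y = y} x∈ ≡.refl) (ρ-cong (+-identityˡ y))

  ρ-+-radʳ : ∀ x {y} → Rad y → ρ (x + y) ≡ ρ x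
  ρ-+-radʳ x y∈ = ≡.trans (ρ-+ {x = x} ≡.refl y∈) (ρ-cong (+-identityʳ x))

  ≡⇒Rad-diff : ∀ {x y} → ρ x ≡ ρ y → Rad (x - y)
  ≡⇒Rad-diff {x} {y} e = ≡.trans (ρ-+ {y = - y} e ≡.refl) (ρ-cong (-‿inverseʳ y))

  Rad-diff⇒≡ : ∀ {x y} → Rad (x - y) → ρ x ≡ ρ y
  Rad-diff⇒≡ {x} {y} d∈ = ≡.trans (ρ-cong (sym (//-rightDividesˡ y x))) (ρ-+-radˡ y d∈)

  -- The difference of the two sides is a product of two radical elements. So a product with a
  -- radical factor depends on the other factor only through its residue.
  *-congʳ-rad : ∀ {x y z} → ρ x ≡ ρ y → Rad z → x * z ≈ y * z
  *-congʳ-rad {x} {y} {z} e z∈ = x∙y⁻¹≈ε⇒x≈y _ _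
    (trans (sym ([y-z]x≈yx-zx z x y)) (rad*rad (≡⇒Rad-diff e) z∈))

  *-congˡ-rad : ∀ {x y z} → Rad z → ρ x ≡ ρ y → z * x ≈ z * y
  *-congˡ-rad {x} {y} {z} z∈ e = x∙y⁻¹≈ε⇒x≈y _ _
    (trans (sym (x[y-z]≈xy-xz z x y)) (rad*rad z∈ (≡⇒Rad-diff e)))

  unit-cancelʳ : ∀ {x y} → ρ y ≢ 𝟎 → x * y ≈ 0# → x ≈ 0#
  unit-cancelʳ {x} {y} y∉ xy≈0 = let y⁻¹ , yy⁻¹≈1 , _ = unit y y∉ in begin
    x               ≈⟨ *-identityʳ x ⟨
    x * 1#          ≈⟨ *-congˡ yy⁻¹≈1 ⟨
    x * (y * y⁻¹)   ≈⟨ *-assoc x y y⁻¹ ⟨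
    x * y * y⁻¹     ≈⟨ *-congʳ xy≈0 ⟩
    0# * y⁻¹        ≈⟨ zeroˡ y⁻¹ ⟩
    0#              ∎

  -- If x were a unit, it could be cancelled and θ would be 0.
  θ*≈0⇒Rad : ∀ {x} → θ * x ≈ 0# → Rad x
  θ*≈0⇒Rad {x} θx≈0 = Dec.decidable-stable (ρ x Fin.≟ 𝟎) λ x∉ → θ≉0 (unit-cancelʳ x∉ θx≈0)

  θ*-injective : ∀ {x y} → θ * x ≈ θ * y → ρ x ≡ ρ y
  θ*-injective {x} {y} e = Rad-diff⇒≡ (θ*≈0⇒Rad
    (trans (x[y-z]≈xy-xz θ x y) (x≈y⇒x∙y⁻¹≈ε e)))

  j-injective : ∀ {c d} → j c ≈ j d → c ≡ d
  j-injective {c} {d} e = ≡.trans (≡.sym (ρ-T c)) (≡.trans (θ*-injective e) (ρ-T d))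

  ≈0⇒Rad : ∀ {x} → x ≈ 0# → Rad x
  ≈0⇒Rad = ρ-cong

  𝟏≢𝟎 : 𝟏 ≢ 𝟎
  𝟏≢𝟎 1∈ = θ≉0 (trans (sym (*-identityʳ θ)) (rad*rad θ∈rad 1∈))

  j≈0⇒≡𝟎 : ∀ {c} → j c ≈ 0# → c ≡ 𝟎
  j≈0⇒≡𝟎 {c} e = ≡.trans (≡.sym (ρ-T c)) (θ*≈0⇒Rad e)

  j𝟎≈0 : j 𝟎 ≈ 0#
  j𝟎≈0 = rad*rad θ∈rad (ρ-T 𝟎)

  j𝟏≈θ : j 𝟏 ≈ θ
  j𝟏≈θ = trans (*-congˡ T-1) (*-identityʳ θ)

  Rad⇒j : ∀ {x} → Rad x → ∃ λ d → x ≈ j d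
  Rad⇒j x∈ = let t , x≈ = rad⊆θR x∈ in ρ t , trans x≈ (*-congˡ-rad θ∈rad (≡.sym (ρ-T (ρ t))))

  -- The first digit is the residue; what is left after subtracting its lift is radical, hence some
  -- `j d`.
  expansion : ∀ {x a} → ρ x ≡ a → ∃ λ d → x ≈ T a + j d
  expansion {x} {a} e = let d , x-a≈ = Rad⇒j (≡⇒Rad-diff (≡.trans e (≡.sym (ρ-T a)))) in
    d , (begin
      x                ≈⟨ //-rightDividesˡ (T a) x ⟨
      x - T a + T a    ≈⟨ +-comm _ _ ⟩
      T a + (x - T a)  ≈⟨ +-congˡ x-a≈ ⟩
      T a + j d        ∎)

  ρ-expansion : ∀ a d → ρ (T a + j d) ≡ a
  ρ-expansion a d = ≡.trans (ρ-+-radʳ (T a) (Rad-j d)) (ρ-T a)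

  ρ-*-cancelˡ : ∀ {m x y} → ρ m ≢ 𝟎 → ρ (m * x) ≡ ρ (m * y) → ρ x ≡ ρ y
  ρ-*-cancelˡ {m} {x} {y} m∉ e = let m⁻¹ , _ , m⁻¹m≈1 = unit m m∉ in
    ≡.trans (ρ-cong (sym (undo m⁻¹m≈1 x))) (≡.trans (ρ-* {x = m⁻¹} ≡.refl e) (ρ-cong (undo m⁻¹m≈1 y)))
    where
    undo : ∀ {m⁻¹} → m⁻¹ * m ≈ 1# → ∀ x → m⁻¹ * (m * x) ≈ x
    undo e x = trans (sym (*-assoc _ m x)) (trans (*-congʳ e) (*-identityˡ x))

  ρ-+-cancelʳ : ∀ {x y} b → ρ (x + b) ≡ ρ (y + b) → ρ x ≡ ρ y
  ρ-+-cancelʳ {x} {y} b e = ≡.trans (ρ-cong (sym (//-rightDividesʳ b x)))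
    (≡.trans (ρ-+ {y = - b} e ≡.refl) (ρ-cong (//-rightDividesʳ b y)))

  unit-solve : ∀ m b → ρ m ≢ 𝟎 → ∀ y → ∃ λ x → y ≈ m * x + b
  unit-solve m b m∉ y = let m⁻¹ , mm⁻¹≈1 , _ = unit m m∉ in m⁻¹ * (y - b) , sym (begin
    m * (m⁻¹ * (y - b)) + b  ≈⟨ +-congʳ (*-assoc m m⁻¹ _) ⟨
    m * m⁻¹ * (y - b) + b    ≈⟨ +-congʳ (*-congʳ mm⁻¹≈1) ⟩
    1# * (y - b) + b         ≈⟨ +-congʳ (*-identityˡ _) ⟩
    y - b + b                ≈⟨ //-rightDividesˡ b y ⟩
    y                        ∎)

  -- The equation reads (b - 1)z = e - m, and b - 1 is a unit. It expresses that a line meets a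
  -- segment over z = 0 whose direction, y = z or x = z, differs from its own.
  fixed-solve : ∀ {m b e} → ρ b ≢ 𝟏 → Rad m → Rad e → ∃ λ z → Rad z × z + e ≈ m + b * z
  fixed-solve {m} {b} {e} b≢𝟏 m∈ e∈ = z , Rad-*ˡ u⁻¹ (Rad-+ e∈ (Rad-neg m∈)) , sym (begin
    m + b * z                      ≈⟨ +-congˡ (*-congʳ (//-rightDividesˡ 1# b)) ⟨
    m + (b - 1# + 1#) * z          ≈⟨ +-congˡ (distribʳ z (b - 1#) 1#) ⟩
    m + ((b - 1#) * z + 1# * z)    ≈⟨ +-congˡ (+-cong uz≈ (*-identityˡ z)) ⟩
    m + (e - m + z)                ≈⟨ +-assoc m (e - m) z ⟨
    m + (e - m) + z                ≈⟨ +-congʳ (trans (+-comm m (e - m)) (//-rightDividesˡ m e)) ⟩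
    e + z                          ≈⟨ +-comm e z ⟩
    z + e                          ∎)
    where
    u∉ : ρ (b - 1#) ≢ 𝟎
    u∉ u∈ = b≢𝟏 (Rad-diff⇒≡ u∈)
    u⁻¹ = proj₁ (unit (b - 1#) u∉)
    z = u⁻¹ * (e - m)
    uz≈ : (b - 1#) * z ≈ e - m
    uz≈ = trans (sym (*-assoc _ u⁻¹ _)) (trans (*-congʳ (proj₁ (proj₂ (unit (b - 1#) u∉)))) (*-identityˡ _))

  -- Write m = θs and e = θt. Since m is nonzero, s is a unit, and x = s⁻¹t works.
  rad-solve : ∀ {m e} → Rad m → ¬ m ≈ 0# → Rad e → ∃ λ x → m * x ≈ e
  rad-solve {m} {e} m∈ m≉0 e∈ with rad⊆θR m∈ | rad⊆θR e∈
  ... | s , m≈θs | t , e≈θt = s⁻¹ * t , (begin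
    m * (s⁻¹ * t)        ≈⟨ *-congʳ m≈θs ⟩
    θ * s * (s⁻¹ * t)    ≈⟨ *-assoc θ s _ ⟩
    θ * (s * (s⁻¹ * t))  ≈⟨ *-congˡ (*-assoc s s⁻¹ t) ⟨
    θ * (s * s⁻¹ * t)    ≈⟨ *-congˡ (*-congʳ (proj₁ (proj₂ (unit s s∉)))) ⟩
    θ * (1# * t)         ≈⟨ *-congˡ (*-identityˡ t) ⟩
    θ * t                ≈⟨ e≈θt ⟨
    e                    ∎)
    where
    s∉ : ρ s ≢ 𝟎
    s∉ s∈ = m≉0 (trans m≈θs (rad*rad θ∈rad s∈))
    s⁻¹ = proj₁ (unit s s∉)

  -- A radical slope does not see the second digit, so a line with such a slope contains a whole
  -- segment x + `j d` as soon as it contains one point of it.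
  *-expansion : ∀ {m} → Rad m → ∀ x d → m * (x + j d) ≈ m * x
  *-expansion m∈ x d = *-congˡ-rad m∈ (ρ-+-radʳ x (Rad-j d))

-- The blocking set

module Pseudolines {R : Ring c ℓ} {q : ℕ} (chain : Chain R q) where
  open Ring R hiding (zero)
  open RingProperties R
  open Chain chain
  open Residues chain
  open RightModule (PHG.R³ R) using (_≈ᴹ_; Carrierᴹ; ≈ᴹ-trans)

  -- Over x ≡ c, the line y = 1 + θ (T c) (x - 1) has y = w c.
  w : Fin q → Carrier
  w c = 1# + θ * (T c * (T c - 1#))

  -- inj₁ (a , d) stands for the coordinate T a + j d along the affine part of a
  -- pseudoline, inj₂ d for its points over the line z = 0.
  Index : Set
  Index = (Fin q × Fin q) ⊎ Fin q

  -- The first two clauses are the crossings with y = 0 and y = z, where the segment is turned and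
  -- lies at height `j c` or `w c`. Elsewhere, and for c = 1 also at (1:1:1), it follows x = T c +
  -- θy. The decisions are arguments so that proofs can match on them.
  verticalPoint : ∀ (c a d : Fin q) → Dec (a ≡ 𝟎) → Dec (a ≡ 𝟏) → Dec (c ≡ 𝟏) → Carrierᴹ
  verticalPoint c a d (yes _) _       _       = T c + j d , j c , 1#
  verticalPoint c a d (no _)  (yes _) (no _)  = T c + j d , w c , 1#
  verticalPoint c a d (no _)  (yes _) (yes _) = T c + θ * T a , T a + j d , 1#
  verticalPoint c a d (no _)  (no _)  _       = T c + θ * T a , T a + j d , 1#

  horizontalPoint : ∀ (a d : Fin q) → Dec (a ≡ 𝟏) → Carrierᴹ
  horizontalPoint a d (yes _) = 1# , T a + j d , 1#
  horizontalPoint a d (no _)  = T a + j d , 1# , 1#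

  𝓛-vector-suc : ∀ (c : Fin q) → Dec (c ≡ 𝟎) → Index → Carrierᴹ
  𝓛-vector-suc c (yes _) (inj₁ (a , d)) = horizontalPoint a d (a Fin.≟ 𝟏)
  -- The shift by θ separates this segment from the parallel one of the pseudoline over y = 0.
  𝓛-vector-suc c (yes _) (inj₂ d)       = 1# , j d + θ , j d
  𝓛-vector-suc c (no _)  (inj₁ (a , d)) = verticalPoint c a d (a Fin.≟ 𝟎) (a Fin.≟ 𝟏) (c Fin.≟ 𝟏)
  -- All pseudolines over x = cz pass over (0:1:0); the shift `j c` tells their parallel segments
  -- apart.
  𝓛-vector-suc c (no _)  (inj₂ d)       = j d + j c , 1# , j d

  𝓛-vector : Fin (suc q) → Index → Carrierᴹ
  𝓛-vector zero    (inj₁ (a , d)) = T a + j d , 0# , 1#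
  𝓛-vector zero    (inj₂ d)       = 1# , j d , j d
  𝓛-vector (suc c) s              = 𝓛-vector-suc c (c Fin.≟ 𝟎) s

  infix 4 _∈𝓛_

  _∈𝓛_ : Carrierᴹ → Fin (suc q) → Set ℓ
  v ∈𝓛 i = ∃ λ s → 𝓛-vector i s ≈ᴹ v

  ∈𝓛-resp : ∀ {i v v′} → v ≈ᴹ v′ → v ∈𝓛 i → v′ ∈𝓛 i
  ∈𝓛-resp v≈ (s , e) = s , ≈ᴹ-trans e v≈

  base-affine : ∀ x → (x , 0# , 1#) ∈𝓛 zero
  base-affine x = let d , e = expansion {x} ≡.refl in inj₁ (ρ x , d) , (sym e , refl , refl)

  base-infinite : ∀ {z} → Rad z → (1# , z , z) ∈𝓛 zero
  base-infinite z∈ = let d , e = Rad⇒j z∈ in inj₂ d , (refl , sym e , sym e)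

  horizontal-affine : ∀ {x} → ρ x ≢ 𝟏 → (x , 1# , 1#) ∈𝓛 suc 𝟎
  horizontal-affine {x} x≢ = inj₁ (ρ x , d) , lem
    where
    d = proj₁ (expansion {x} ≡.refl)
    lem : 𝓛-vector (suc 𝟎) (inj₁ (ρ x , d)) ≈ᴹ (x , 1# , 1#)
    lem with 𝟎 Fin.≟ 𝟎
    ... | no ≢  = ⊥-elim (≢ ≡.refl)
    ... | yes _ with ρ x Fin.≟ 𝟏
    ...   | yes e = ⊥-elim (x≢ e)
    ...   | no _  = sym (proj₂ (expansion {x} ≡.refl)) , refl , refl

  horizontal-turned : ∀ {y} → ρ y ≡ 𝟏 → (1# , y , 1#) ∈𝓛 suc 𝟎
  horizontal-turned {y} y≡ = inj₁ (𝟏 , d) , lem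
    where
    d = proj₁ (expansion y≡)
    lem : 𝓛-vector (suc 𝟎) (inj₁ (𝟏 , d)) ≈ᴹ (1# , y , 1#)
    lem with 𝟎 Fin.≟ 𝟎
    ... | no ≢  = ⊥-elim (≢ ≡.refl)
    ... | yes _ with 𝟏 Fin.≟ 𝟏
    ...   | no ≢  = ⊥-elim (≢ ≡.refl)
    ...   | yes _ = refl , sym (proj₂ (expansion y≡)) , refl

  horizontal-infinite : ∀ {z} → Rad z → (1# , z + θ , z) ∈𝓛 suc 𝟎
  horizontal-infinite {z} z∈ = inj₂ d , lem
    where
    d = proj₁ (Rad⇒j z∈)
    jd≈z = sym (proj₂ (Rad⇒j z∈))
    lem : 𝓛-vector (suc 𝟎) (inj₂ d) ≈ᴹ (1# , z + θ , z)
    lem with 𝟎 Fin.≟ 𝟎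
    ... | no ≢  = ⊥-elim (≢ ≡.refl)
    ... | yes _ = refl , +-congʳ jd≈z , jd≈z

  module _ {c : Fin q} (c≢𝟎 : c ≢ 𝟎) where

    vertical-0 : ∀ {x} → ρ x ≡ c → (x , j c , 1#) ∈𝓛 suc c
    vertical-0 {x} x≡ = inj₁ (𝟎 , d) , lem
      where
      d = proj₁ (expansion x≡)
      lem : 𝓛-vector (suc c) (inj₁ (𝟎 , d)) ≈ᴹ (x , j c , 1#)
      lem with c Fin.≟ 𝟎
      ... | yes e = ⊥-elim (c≢𝟎 e)
      ... | no _ with 𝟎 Fin.≟ 𝟎
      ...   | no ≢  = ⊥-elim (≢ ≡.refl)
      ...   | yes _ = sym (proj₂ (expansion x≡)) , refl , refl

    vertical-1 : c ≢ 𝟏 → ∀ {x} → ρ x ≡ c → (x , w c , 1#) ∈𝓛 suc c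
    vertical-1 c≢𝟏 {x} x≡ = inj₁ (𝟏 , d) , lem
      where
      d = proj₁ (expansion x≡)
      lem : 𝓛-vector (suc c) (inj₁ (𝟏 , d)) ≈ᴹ (x , w c , 1#)
      lem with c Fin.≟ 𝟎
      ... | yes e = ⊥-elim (c≢𝟎 e)
      ... | no _ with 𝟏 Fin.≟ 𝟎 | 𝟏 Fin.≟ 𝟏 | c Fin.≟ 𝟏
      ...   | yes e | _     | _     = ⊥-elim (𝟏≢𝟎 e)
      ...   | no _  | no ≢  | _     = ⊥-elim (≢ ≡.refl)
      ...   | no _  | yes _ | yes e = ⊥-elim (c≢𝟏 e)
      ...   | no _  | yes _ | no _  = sym (proj₂ (expansion x≡)) , refl , refl

    -- The hypotheses exclude exactly the residues of y at which the segment is turned. As θy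
    -- depends only on the residue of y, its lift may stand for y in the first coordinate.
    vertical-affine : ∀ {y} → ρ y ≢ 𝟎 → (ρ y ≡ 𝟏 → c ≡ 𝟏) → (T c + θ * y , y , 1#) ∈𝓛 suc c
    vertical-affine {y} y≢𝟎 y≡𝟏⇒ = inj₁ (ρ y , d) , lem
      where
      d = proj₁ (expansion {y} ≡.refl)
      eqs : (T c + θ * T (ρ y) , T (ρ y) + j d , 1#) ≈ᴹ (T c + θ * y , y , 1#)
      eqs = +-congˡ (*-congˡ-rad θ∈rad (ρ-T (ρ y))) , sym (proj₂ (expansion {y} ≡.refl)) , refl
      lem : 𝓛-vector (suc c) (inj₁ (ρ y , d)) ≈ᴹ (T c + θ * y , y , 1#)
      lem with c Fin.≟ 𝟎
      ... | yes e = ⊥-elim (c≢𝟎 e)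
      ... | no _ with ρ y Fin.≟ 𝟎 | ρ y Fin.≟ 𝟏 | c Fin.≟ 𝟏
      ...   | yes e | _     | _     = ⊥-elim (y≢𝟎 e)
      ...   | no _  | no _  | _     = eqs
      ...   | no _  | yes e | no ≢  = ⊥-elim (≢ (y≡𝟏⇒ e))
      ...   | no _  | yes _ | yes _ = eqs

    vertical-infinite : ∀ {z} → Rad z → (z + j c , 1# , z) ∈𝓛 suc c
    vertical-infinite {z} z∈ = inj₂ d , lem
      where
      d = proj₁ (Rad⇒j z∈)
      jd≈z = sym (proj₂ (Rad⇒j z∈))
      lem : 𝓛-vector (suc c) (inj₂ d) ≈ᴹ (z + j c , 1# , z)
      lem with c Fin.≟ 𝟎
      ... | yes e = ⊥-elim (c≢𝟎 e)
      ... | no _  = +-congʳ jd≈z , refl , jd≈z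

  -- Disjointness of the pseudolines.

  Affine₁ : Carrier → Carrier → Set ℓ
  Affine₁ x y = (y ≈ 1# × ρ x ≢ 𝟏) ⊎ (x ≈ 1# × ρ y ≡ 𝟏)

  -- `y≉0` separates the point from the pseudoline over y = 0; `y≈1⇒` and `x≈1⇒` separate it from
  -- the straight and the turned part of the one over y = z.
  record Affine₂ (c : Fin q) (x y : Carrier) : Set ℓ where
    field
      x≡c     : ρ x ≡ c
      y≉0     : ¬ y ≈ 0#
      y≈1⇒    : y ≈ 1# → ρ x ≡ 𝟏
      x≈1⇒    : x ≈ 1# → ρ y ≢ 𝟏

  -- Necessary conditions for membership, free of the index: enough to tell the pseudolines apart
  -- and to see that their vectors are normalised.
  Signature : Fin (suc q) → Carrierᴹ → Set ℓ
  Signature zero (x , y , z) = (z ≈ 1# × y ≈ 0#) ⊎ (x ≈ 1# × Rad z × y ≈ z)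
  Signature (suc c) (x , y , z) =
    (c ≡ 𝟎 × (z ≈ 1# × Affine₁ x y ⊎ x ≈ 1# × Rad z × y ≈ z + θ)) ⊎
    (c ≢ 𝟎 × (z ≈ 1# × Affine₂ c x y ⊎ y ≈ 1# × Rad z × x ≈ z + j c))

  Rad-resp : ∀ {x y} → x ≈ y → Rad x → Rad y
  Rad-resp e x∈ = ≡.trans (ρ-cong (sym e)) x∈

  Rad⇒≉1 : ∀ {x} → Rad x → ¬ x ≈ 1#
  Rad⇒≉1 x∈ x≈1 = 𝟏≢𝟎 (≡.trans (ρ-cong (sym x≈1)) x∈)

  ρ-w : ∀ c → ρ (w c) ≡ 𝟏
  ρ-w c = ρ-+-radʳ 1# (Rad-* _ θ∈rad)

  -- For c other than 0 and 1 both `T c` and `T c` - 1 are units, so θ times their product is not 0.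
  w≉1 : ∀ {c} → c ≢ 𝟎 → c ≢ 𝟏 → ¬ w c ≈ 1#
  w≉1 {c} c≢𝟎 c≢𝟏 w≈1 = c≢𝟏 (≡.trans (≡.sym (ρ-T c)) (Rad-diff⇒≡ T-1∈))
    where
    θTT≈0 : θ * (T c * (T c - 1#)) ≈ 0#
    θTT≈0 = +-cancelˡ 1# _ _ (trans w≈1 (sym (+-identityʳ 1#)))
    T-1∈ : Rad (T c - 1#)
    T-1∈ = ρ-*-cancelˡ (λ e → c≢𝟎 (≡.trans (≡.sym (ρ-T c)) e))
      (≡.trans (θ*≈0⇒Rad θTT≈0) (ρ-cong (sym (zeroʳ (T c)))))

  signature : ∀ i {v} → v ∈𝓛 i → Signature i v
  signature zero (inj₁ (a , d) , (_ , 0≈y , 1≈z)) = inj₁ (sym 1≈z , sym 0≈y)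
  signature zero (inj₂ d , (1≈x , jd≈y , jd≈z)) =
    inj₂ (sym 1≈x , Rad-resp jd≈z (Rad-j d) , trans (sym jd≈y) jd≈z)
  signature (suc c) (s , e) with c Fin.≟ 𝟎
  signature (suc c) (inj₁ (a , d) , e) | yes c≡𝟎 with a Fin.≟ 𝟏
  ... | yes a≡𝟏 = let (1≈x , a≈y , 1≈z) = e in
    inj₁ (c≡𝟎 , inj₁ (sym 1≈z , inj₂ (sym 1≈x , ≡.trans (ρ-cong (sym a≈y)) (≡.trans (ρ-expansion a d) a≡𝟏))))
  ... | no a≢𝟏  = let (a≈x , 1≈y , 1≈z) = e in
    inj₁ (c≡𝟎 , inj₁ (sym 1≈z , inj₁ (sym 1≈y ,
      λ x≡𝟏 → a≢𝟏 (≡.trans (≡.sym (ρ-expansion a d)) (≡.trans (ρ-cong a≈x) x≡𝟏)))))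
  signature (suc c) (inj₂ d , (1≈x , y≈ , jd≈z)) | yes c≡𝟎 =
    inj₁ (c≡𝟎 , inj₂ (sym 1≈x , Rad-resp jd≈z (Rad-j d) , trans (sym y≈) (+-congʳ jd≈z)))
  signature (suc c) (inj₂ d , (x≈ , 1≈y , jd≈z)) | no c≢𝟎 =
    inj₂ (c≢𝟎 , inj₂ (sym 1≈y , Rad-resp jd≈z (Rad-j d) , trans (sym x≈) (+-congʳ jd≈z)))
  signature (suc c) {x , y , z} (inj₁ (a , d) , e) | no c≢𝟎 =
    inj₂ (c≢𝟎 , affine (a Fin.≟ 𝟎) (a Fin.≟ 𝟏) (c Fin.≟ 𝟏) e)
    where
    generic : a ≢ 𝟎 → (a ≡ 𝟏 → c ≡ 𝟏) → (T c + θ * T a , T a + j d , 1#) ≈ᴹ (x , y , z) →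
              (z ≈ 1# × Affine₂ c x y) ⊎ (y ≈ 1# × Rad z × x ≈ z + j c)
    generic a≢𝟎 a≡𝟏⇒ (x≈ , y≈ , 1≈z) = inj₁ (sym 1≈z , record
      { x≡c = x≡c
      ; y≉0 = λ y≈0 → a≢𝟎 (≡.trans (≡.sym y≡a) (≈0⇒Rad y≈0))
      ; y≈1⇒ = λ y≈1 → ≡.trans x≡c (a≡𝟏⇒ (≡.trans (≡.sym y≡a) (ρ-cong y≈1)))
      -- If x = 1, then c is the residue 1 and `T c` = 1, so the remaining θ `T a` vanishes, against
      -- a ≠ 0.
      ; x≈1⇒ = λ x≈1 _ → a≢𝟎 (j≈0⇒≡𝟎 (+-cancelˡ 1# _ _ (trans
          (+-congʳ (sym (trans (reflexive (≡.cong T (≡.trans (≡.sym x≡c) (ρ-cong x≈1)))) T-1)))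
          (trans x≈ (trans x≈1 (sym (+-identityʳ 1#)))))))
      })
      where
      x≡c = ≡.trans (ρ-cong (sym x≈)) (ρ-expansion c a)
      y≡a = ≡.trans (ρ-cong (sym y≈)) (ρ-expansion a d)
    affine : ∀ a? a₁? c? → verticalPoint c a d a? a₁? c? ≈ᴹ (x , y , z) →
             (z ≈ 1# × Affine₂ c x y) ⊎ (y ≈ 1# × Rad z × x ≈ z + j c)
    affine (yes a≡𝟎) _ _ (x≈ , y≈ , 1≈z) = inj₁ (sym 1≈z , record
      { x≡c = ≡.trans (ρ-cong (sym x≈)) (ρ-expansion c d)
      ; y≉0 = λ y≈0 → c≢𝟎 (j≈0⇒≡𝟎 (trans y≈ y≈0))
      ; y≈1⇒ = λ y≈1 → ⊥-elim (Rad⇒≉1 (Rad-j c) (trans y≈ y≈1))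
      ; x≈1⇒ = λ _ y≡𝟏 → 𝟏≢𝟎 (≡.trans (≡.sym y≡𝟏) (≡.trans (ρ-cong (sym y≈)) (Rad-j c)))
      })
    affine (no _) (yes _) (no c≢𝟏) (x≈ , y≈ , 1≈z) = inj₁ (sym 1≈z , record
      { x≡c = x≡c
      ; y≉0 = λ y≈0 → 𝟏≢𝟎 (≡.trans (≡.sym (ρ-w c)) (≈0⇒Rad (trans y≈ y≈0)))
      ; y≈1⇒ = λ y≈1 → ⊥-elim (w≉1 c≢𝟎 c≢𝟏 (trans y≈ y≈1))
      ; x≈1⇒ = λ x≈1 _ → c≢𝟏 (≡.trans (≡.sym x≡c) (ρ-cong x≈1))
      })
      where x≡c = ≡.trans (ρ-cong (sym x≈)) (ρ-expansion c d)
    affine (no a≢𝟎) (yes _) (yes c≡𝟏) e = generic a≢𝟎 (λ _ → c≡𝟏) e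
    affine (no a≢𝟎) (no a≢𝟏) _ e = generic a≢𝟎 (λ a≡𝟏 → ⊥-elim (a≢𝟏 a≡𝟏)) e

  private
    zero-suc : ∀ {c v} → Signature zero v → Signature (suc c) v → ⊥
    zero-suc (inj₁ (_ , y≈0)) (inj₁ (_ , inj₁ (_ , inj₁ (y≈1 , _)))) = Rad⇒≉1 (≈0⇒Rad y≈0) y≈1
    zero-suc (inj₁ (_ , y≈0)) (inj₁ (_ , inj₁ (_ , inj₂ (_ , y≡𝟏)))) = 𝟏≢𝟎 (≡.trans (≡.sym y≡𝟏) (≈0⇒Rad y≈0))
    zero-suc (inj₁ (z≈1 , _)) (inj₁ (_ , inj₂ (_ , z∈ , _))) = Rad⇒≉1 z∈ z≈1
    zero-suc (inj₁ (_ , y≈0)) (inj₂ (_ , inj₁ (_ , A))) = Affine₂.y≉0 A y≈0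
    zero-suc (inj₁ (z≈1 , _)) (inj₂ (_ , inj₂ (_ , z∈ , _))) = Rad⇒≉1 z∈ z≈1
    zero-suc (inj₂ (_ , z∈ , _)) (inj₁ (_ , inj₁ (z≈1 , _))) = Rad⇒≉1 z∈ z≈1
    zero-suc (inj₂ (_ , _ , y≈z)) (inj₁ (_ , inj₂ (_ , _ , y≈z+θ))) =
      θ≉0 (+-cancelˡ _ _ _ (trans (sym y≈z+θ) (trans y≈z (sym (+-identityʳ _)))))
    zero-suc (inj₂ (_ , z∈ , _)) (inj₂ (_ , inj₁ (z≈1 , _))) = Rad⇒≉1 z∈ z≈1
    zero-suc (inj₂ (_ , z∈ , y≈z)) (inj₂ (_ , inj₂ (y≈1 , _))) = Rad⇒≉1 z∈ (trans (sym y≈z) y≈1)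

    horizontal-vertical : ∀ {c x y z} → (z ≈ 1# × Affine₁ x y) ⊎ (x ≈ 1# × Rad z × y ≈ z + θ) →
                          (z ≈ 1# × Affine₂ c x y) ⊎ (y ≈ 1# × Rad z × x ≈ z + j c) → ⊥
    horizontal-vertical (inj₁ (_ , inj₁ (y≈1 , x≢𝟏))) (inj₁ (_ , A)) = x≢𝟏 (Affine₂.y≈1⇒ A y≈1)
    horizontal-vertical (inj₁ (_ , inj₂ (x≈1 , y≡𝟏))) (inj₁ (_ , A)) = Affine₂.x≈1⇒ A x≈1 y≡𝟏
    horizontal-vertical (inj₁ (z≈1 , _)) (inj₂ (_ , z∈ , _)) = Rad⇒≉1 z∈ z≈1
    horizontal-vertical (inj₂ (_ , z∈ , _)) (inj₁ (z≈1 , _)) = Rad⇒≉1 z∈ z≈1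
    horizontal-vertical (inj₂ (_ , z∈ , y≈)) (inj₂ (y≈1 , _)) =
      Rad⇒≉1 (Rad-+ z∈ θ∈rad) (trans (sym y≈) y≈1)

    vertical-vertical : ∀ {c c′ x y z} → (z ≈ 1# × Affine₂ c x y) ⊎ (y ≈ 1# × Rad z × x ≈ z + j c) →
                        (z ≈ 1# × Affine₂ c′ x y) ⊎ (y ≈ 1# × Rad z × x ≈ z + j c′) → c ≡ c′
    vertical-vertical (inj₁ (_ , A)) (inj₁ (_ , A′)) = ≡.trans (≡.sym (Affine₂.x≡c A)) (Affine₂.x≡c A′)
    vertical-vertical (inj₁ (z≈1 , _)) (inj₂ (_ , z∈ , _)) = ⊥-elim (Rad⇒≉1 z∈ z≈1)
    vertical-vertical (inj₂ (_ , z∈ , _)) (inj₁ (z≈1 , _)) = ⊥-elim (Rad⇒≉1 z∈ z≈1)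
    vertical-vertical (inj₂ (_ , _ , x≈)) (inj₂ (_ , _ , x≈′)) =
      j-injective (+-cancelˡ _ _ _ (trans (sym x≈) x≈′))

    suc-suc : ∀ {c c′ v} → Signature (suc c) v → Signature (suc c′) v → c ≡ c′
    suc-suc (inj₁ (c≡𝟎 , _)) (inj₁ (c′≡𝟎 , _)) = ≡.trans c≡𝟎 (≡.sym c′≡𝟎)
    suc-suc (inj₁ (_ , H)) (inj₂ (_ , V)) = ⊥-elim (horizontal-vertical H V)
    suc-suc (inj₂ (_ , V)) (inj₁ (_ , H)) = ⊥-elim (horizontal-vertical H V)
    suc-suc (inj₂ (_ , V)) (inj₂ (_ , V′)) = vertical-vertical V V′

  𝓛-disjoint : ∀ {i i′ v} → v ∈𝓛 i → v ∈𝓛 i′ → i ≡ i′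
  𝓛-disjoint {i} {i′} v∈ v∈′ = go i i′ (signature i v∈) (signature i′ v∈′)
    where
    go : ∀ i i′ {v} → Signature i v → Signature i′ v → i ≡ i′
    go zero    zero    _ _  = ≡.refl
    go zero    (suc _) s s′ = ⊥-elim (zero-suc s s′)
    go (suc _) zero    s s′ = ⊥-elim (zero-suc s′ s)
    go (suc _) (suc _) s s′ = ≡.cong suc (suc-suc s s′)

-- Intersections of lines with the pseudolines.

module Lines {R : Ring c ℓ} {q : ℕ} (chain : Chain R q) where
  open Ring R hiding (zero)
  open RingProperties R
  open Chain chain
  open Residues chain
  open Pseudolines chain
  open RightModule (PHG.R³ R) using (_≈ᴹ_; Carrierᴹ)
  open SetoidReasoning setoid

  record Segment (i : Fin (suc q)) (L : Carrierᴹ → Set ℓ) : Set (c ⊔ ℓ) where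
    field
      point     : Fin q → Carrierᴹ
      on        : ∀ d → L (point d)
      in𝓛       : ∀ d → point d ∈𝓛 i
      injective : ∀ {d d′} → point d ≈ᴹ point d′ → d ≡ d′

  record Extra (i : Fin (suc q)) (L : Carrierᴹ → Set ℓ) : Set (c ⊔ ℓ) where
    constructor extra
    field
      {point} : Carrierᴹ
      on      : L point
      in𝓛     : point ∈𝓛 i

  -- Either way, L contains q + 1 points of the blocking set.
  data Blocked (L : Carrierᴹ → Set ℓ) : Set (c ⊔ ℓ) where
    transversal : (∀ i → Extra i L) → Blocked L
    contains    : ∀ {i i′} → i ≢ i′ → Extra i L → Segment i′ L → Blocked L

  +j-injective : ∀ {x d d′} → x + j d ≈ x + j d′ → d ≡ d′
  +j-injective e = j-injective (+-cancelˡ _ _ _ e)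

  affineSegment : ∀ {i L} x {y} → (∀ d → L (x + j d , y , 1#)) →
                  (∀ d → (x + j d , y , 1#) ∈𝓛 i) → Segment i L
  affineSegment x {y} on in𝓛 = record
    { point = λ d → x + j d , y , 1# ; on = on ; in𝓛 = in𝓛 ; injective = λ (e , _) → +j-injective e }

  infiniteSegment : ∀ {i L} (y : Fin q → Carrier) → (∀ d → L (1# , y d , j d)) →
                    (∀ d → (1# , y d , j d) ∈𝓛 i) → Segment i L
  infiniteSegment y on in𝓛 = record
    { point = λ d → 1# , y d , j d ; on = on ; in𝓛 = in𝓛 ; injective = λ (_ , _ , e) → j-injective e }

  module Oblique (m b : Carrier) where

    On : Carrierᴹ → Set ℓ
    On (x , y , z) = y ≈ m * x + b * z

    affine : ∀ {x y} → y ≈ m * x + b → On (x , y , 1#)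
    affine e = trans e (+-congˡ (sym (*-identityʳ b)))

    infinite : ∀ {y z} → y ≈ m + b * z → On (1# , y , z)
    infinite e = trans e (+-congʳ (sym (*-identityʳ m)))

    turned : On (1# , m + b , 1#)
    turned = affine (+-congʳ (sym (*-identityʳ m)))

    -- The intersection with x = T c + θy looks circular, as y in turn depends on x. But θy needs
    -- only the residue of y, which is known from x ≡ c.
    meets-vertical : ∀ {c} → c ≢ 𝟎 → ρ (m * T c + b) ≢ 𝟎 → (ρ (m * T c + b) ≡ 𝟏 → c ≡ 𝟏) →
                     Extra (suc c) On
    meets-vertical {c} c≢𝟎 ≢𝟎 ≡𝟏⇒ = extra (affine (+-congʳ (*-congˡ (+-congˡ (*-congˡ-rad θ∈rad (≡.sym ρy≡))))))
      (vertical-affine c≢𝟎 (λ e → ≢𝟎 (≡.trans (≡.sym ρy≡) e)) (λ e → ≡𝟏⇒ (≡.trans (≡.sym ρy≡) e)))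
      where
      ρy≡ : ρ (m * (T c + θ * (m * T c + b)) + b) ≡ ρ (m * T c + b)
      ρy≡ = ρ-+ (ρ-* {x = m} ≡.refl (ρ-+-radʳ (T c) (Rad-* _ θ∈rad))) ≡.refl

    module _ (m∉ : ρ m ≢ 𝟎) where

      private
        -- As m is a unit, the residue of y on the line determines that of x.
        solve-fibre : ∀ {c y} → ρ y ≡ ρ (m * T c + b) → ∃ λ x → y ≈ m * x + b × ρ x ≡ c
        solve-fibre {c} {y} e = let x , y≈ = unit-solve m b m∉ y in x , y≈ ,
          ≡.trans (ρ-*-cancelˡ m∉ (ρ-+-cancelʳ b (≡.trans (ρ-cong (sym y≈)) e))) (ρ-T c)

        meets : ∀ i → Extra i On
        meets zero = let x , e = unit-solve m b m∉ 0# in extra (affine e) (base-affine x)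
        meets (suc c) with c Fin.≟ 𝟎
        meets (suc c) | yes ≡.refl with unit-solve m b m∉ 1#
        ... | x , e with ρ x Fin.≟ 𝟏
        ...   | no x≢𝟏 = extra (affine e) (horizontal-affine x≢𝟏)
        -- Over (1:1:1) the segment is turned to x = 1, so the intersection is (1, m + b, 1); its
        -- residue agrees with that of mx + b = 1.
        ...   | yes x≡𝟏 = extra turned (horizontal-turned
                (≡.trans (≡.sym (ρ-+ (≡.trans (ρ-* {x = m} ≡.refl x≡𝟏) (ρ-cong (*-identityʳ m))) ≡.refl)) (ρ-cong (sym e))))
        meets (suc c) | no c≢𝟎 with ρ (m * T c + b) Fin.≟ 𝟎
        ... | yes ≡𝟎 = let x , e , x≡c = solve-fibre (≡.trans (Rad-j c) (≡.sym ≡𝟎)) in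
              extra (affine e) (vertical-0 c≢𝟎 x≡c)
        ... | no ≢𝟎 with ρ (m * T c + b) Fin.≟ 𝟏 | c Fin.≟ 𝟏
        ...   | yes ≡𝟏 | no c≢𝟏  = let x , e , x≡c = solve-fibre (≡.trans (ρ-w c) (≡.sym ≡𝟏)) in
                extra (affine e) (vertical-1 c≢𝟎 c≢𝟏 x≡c)
        ...   | yes _  | yes c≡𝟏 = meets-vertical c≢𝟎 ≢𝟎 (λ _ → c≡𝟏)
        ...   | no ≢𝟏  | _       = meets-vertical c≢𝟎 ≢𝟎 (λ ≡𝟏 → ⊥-elim (≢𝟏 ≡𝟏))

      blocked-unit : Blocked On
      blocked-unit = transversal meets

    module _ (m∈ : Rad m) where

      private
        ρ-value : ∀ x → ρ (m * x + b) ≡ ρ b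
        ρ-value x = ρ-+-radˡ b (Rad-* x m∈)

      -- The line lies over y = bz with b neither 0 nor 1. At (1:0:0) the direction of the segments
      -- is y = z, and over (c:b:1) the vertical pseudolines are not turned.
      blocked-generic : ρ b ≢ 𝟎 → ρ b ≢ 𝟏 → Blocked On
      blocked-generic b≢𝟎 b≢𝟏 = transversal meets
        where
        meets : ∀ i → Extra i On
        meets zero = let z , z∈ , e = fixed-solve b≢𝟏 m∈ ≡.refl in
          extra (infinite (trans (sym (+-identityʳ z)) e)) (base-infinite z∈)
        meets (suc c) with c Fin.≟ 𝟎
        ... | yes ≡.refl = let z , z∈ , e = fixed-solve b≢𝟏 m∈ θ∈rad in
              extra (infinite e) (horizontal-infinite z∈)
        ... | no c≢𝟎 = meets-vertical c≢𝟎 (λ e → b≢𝟎 (≡.trans (≡.sym (ρ-value _)) e))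
                (λ e → ⊥-elim (b≢𝟏 (≡.trans (≡.sym (ρ-value _)) e)))

      private
        -- At the crossing (1:0:0): for z = m - θ the term bz vanishes, which leaves y = m = z + θ.
        horizontal-point : Rad b → Extra (suc 𝟎) On
        horizontal-point b∈ = extra
          (infinite (trans (//-rightDividesˡ θ m) (trans (sym (+-identityʳ m)) (+-congˡ (sym (rad*rad b∈ m-θ∈))))))
          (horizontal-infinite m-θ∈)
          where m-θ∈ = Rad-+ m∈ (Rad-neg θ∈rad)

      -- For m ≠ 0 the line reaches y = 0 where mx = -b and contains the base segment there. For m =
      -- 0 it is y = bz with b = `j c`: the height `j c` was given to the pseudoline over x = cz,
      -- and height 0 belongs to the base. The extra point lies over (1:0:0).
      blocked-0 : Rad b → Blocked On
      blocked-0 b∈ with m ≈? 0#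
      ... | no m≉0 = let x , mx≈ = rad-solve m∈ m≉0 (Rad-neg b∈) in
        contains {i = suc 𝟎} {i′ = zero} (λ ()) (horizontal-point b∈)
          (affineSegment x (λ d → affine (sym (trans (+-congʳ (trans (*-expansion m∈ x d) mx≈)) (-‿inverseˡ b))))
            (λ d → base-affine _))
      ... | yes m≈0 with Rad⇒j b∈
      ...   | c , b≈jc with c Fin.≟ 𝟎
      ...     | no c≢𝟎 = contains {i = zero} {i′ = suc c} (λ ())
                (extra (infinite {z = m} (trans (sym (+-identityʳ m)) (+-congˡ (sym (rad*rad b∈ m∈))))) (base-infinite m∈))
                (affineSegment (T c) (λ d → affine (sym (trans (+-congʳ (trans (*-congʳ m≈0) (zeroˡ _)))
                    (trans (+-identityˡ b) b≈jc))))
                  (λ d → vertical-0 c≢𝟎 (ρ-expansion c d)))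
      ...     | yes c≡𝟎 = contains {i = suc 𝟎} {i′ = zero} (λ ())
                (horizontal-point b∈)
                (affineSegment 0# (λ d → affine (sym (trans (+-cong (trans (*-congʳ m≈0) (zeroˡ _))
                    (trans b≈jc (trans (reflexive (≡.cong j c≡𝟎)) j𝟎≈0))) (+-identityˡ 0#))))
                  (λ d → base-affine _))

      private
        b*≈ : ρ b ≡ 𝟏 → ∀ d → b * j d ≈ j d
        b*≈ b≡𝟏 d = trans (*-congʳ-rad b≡𝟏 (Rad-j d)) (*-identityˡ (j d))

        vertical-point : ρ b ≡ 𝟏 → Extra (suc 𝟏) On
        vertical-point b≡𝟏 = meets-vertical 𝟏≢𝟎 (λ e → 𝟏≢𝟎 (≡.trans (≡.sym (≡.trans (ρ-value _) b≡𝟏)) e)) (λ _ → ≡.refl)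

      -- The extra point always comes from the pseudoline over x = z at (1:1:1). The whole segment
      -- lies over (1:0:0), or where the line reaches y = 1, or, if that happens over (1:1:1),
      -- wherever the slope m dictates.
      blocked-1 : ρ b ≡ 𝟏 → Blocked On
      blocked-1 b≡𝟏 with m ≈? 0#
      ... | yes m≈0 = contains {i = suc 𝟏} {i′ = zero} (λ ()) (vertical-point b≡𝟏)
            (infiniteSegment j (λ d → infinite (sym (trans (+-cong m≈0 (b*≈ b≡𝟏 d)) (+-identityˡ _))))
              (λ d → base-infinite (Rad-j d)))
      ... | no m≉0 with rad-solve m∈ m≉0 (≡⇒Rad-diff (≡.sym b≡𝟏))
      ...   | x , mx≈1-b with ρ x Fin.≟ 𝟏
      ...     | no x≢𝟏 = contains {i = suc 𝟏} {i′ = suc 𝟎} (λ e → 𝟏≢𝟎 (Fin.suc-injective e)) (vertical-point b≡𝟏)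
                (affineSegment x (λ d → affine (sym (trans (+-congʳ (trans (*-expansion m∈ x d) mx≈1-b)) (//-rightDividesˡ b 1#))))
                  (λ d → horizontal-affine (λ e → x≢𝟏 (≡.trans (≡.sym (ρ-+-radʳ x (Rad-j d))) e))))
      -- Now m + b = 1, so the line is y = 1 + m(x - 1). Its slope m = `j c` names the pseudoline: c
      -- = 1 gives slope θ and the horizontal segment over z = 0, any other c gives height `w c`
      -- over x = c.
      ...     | yes x≡𝟏 with Rad⇒j m∈
      ...       | c , m≈jc with c Fin.≟ 𝟏
      ...         | yes c≡𝟏 = contains {i = suc 𝟏} {i′ = suc 𝟎} (λ e → 𝟏≢𝟎 (Fin.suc-injective e)) (vertical-point b≡𝟏)
                    (infiniteSegment (λ d → j d + θ) (λ d → infinite (trans (+-comm _ _) (+-cong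
                        (sym (trans m≈jc (trans (reflexive (≡.cong j c≡𝟏)) j𝟏≈θ))) (sym (b*≈ b≡𝟏 d)))))
                      (λ d → horizontal-infinite (Rad-j d)))
      ...         | no c≢𝟏 = contains {i = suc 𝟏} {i′ = suc c} (λ e → c≢𝟏 (≡.sym (Fin.suc-injective e))) (vertical-point b≡𝟏)
                    (affineSegment (T c) (λ d → affine (w≈ d)) (λ d → vertical-1 c≢𝟎 c≢𝟏 (ρ-expansion c d)))
        where
        c≢𝟎 : c ≢ 𝟎
        c≢𝟎 c≡𝟎 = m≉0 (trans m≈jc (trans (reflexive (≡.cong j c≡𝟎)) j𝟎≈0))
        m+b≈1 : m + b ≈ 1#
        m+b≈1 = trans (+-congʳ (trans (sym (trans (*-congˡ-rad m∈ x≡𝟏) (*-identityʳ m))) mx≈1-b)) (//-rightDividesˡ b 1#)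
        w≈ : ∀ d → w c ≈ m * (T c + j d) + b
        w≈ d = begin
          1# + θ * (T c * (T c - 1#))     ≈⟨ +-comm _ _ ⟩
          θ * (T c * (T c - 1#)) + 1#     ≈⟨ +-congʳ (*-assoc θ (T c) _) ⟨
          j c * (T c - 1#) + 1#           ≈⟨ +-cong (*-congʳ (sym m≈jc)) (sym m+b≈1) ⟩
          m * (T c - 1#) + (m + b)        ≈⟨ +-assoc _ m b ⟨
          m * (T c - 1#) + m + b          ≈⟨ +-congʳ (+-congˡ (*-identityʳ m)) ⟨
          m * (T c - 1#) + m * 1# + b     ≈⟨ +-congʳ (distribˡ m _ 1#) ⟨
          m * (T c - 1# + 1#) + b         ≈⟨ +-congʳ (*-congˡ (//-rightDividesˡ 1# (T c))) ⟩
          m * T c + b                     ≈⟨ +-congʳ (*-expansion m∈ (T c) d) ⟨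
          m * (T c + j d) + b             ∎

    blocked : Blocked On
    blocked with ρ m Fin.≟ 𝟎 | ρ b Fin.≟ 𝟎 | ρ b Fin.≟ 𝟏
    ... | no m∉  | _      | _       = blocked-unit m∉
    ... | yes m∈ | yes b∈ | _       = blocked-0 m∈ b∈
    ... | yes m∈ | no _   | yes b≡𝟏 = blocked-1 m∈ b≡𝟏
    ... | yes m∈ | no b∉  | no b≢𝟏  = blocked-generic m∈ b∉ b≢𝟏

  module Steep (k b : Carrier) (k∈ : Rad k) where

    On : Carrierᴹ → Set ℓ
    On (x , y , z) = x ≈ k * y + b * z

    private
      affine : ∀ {x y} → x ≈ k * y + b → On (x , y , 1#)
      affine e = trans e (+-congˡ (sym (*-identityʳ b)))

      infinite : ∀ {x z} → x ≈ k + b * z → On (x , 1# , z)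
      infinite e = trans e (+-congʳ (sym (*-identityʳ k)))

      base-point : Extra zero On
      base-point = extra (affine (sym (trans (+-congʳ (zeroʳ k)) (+-identityˡ b)))) (base-affine b)

    -- Unless b ≡ 1, the line differs in direction from the segments over (0:1:0) and meets every
    -- pseudoline. If b ≡ 1, the pseudoline over y = 0 gives the extra point at (1:0:1), and every
    -- choice of k and b needs its own segment.
    blocked : Blocked On
    blocked with ρ b Fin.≟ 𝟏
    ... | no b≢𝟏 = transversal meets
      where
      meets : ∀ i → Extra i On
      meets zero = base-point
      meets (suc c) with c Fin.≟ 𝟎
      ... | yes ≡.refl = extra {point = k + b , 1# , 1#} (affine (+-congʳ (sym (*-identityʳ k))))
              (horizontal-affine (λ e → b≢𝟏 (≡.trans (≡.sym (ρ-+-radˡ b k∈)) e)))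
      ... | no c≢𝟎 = let z , z∈ , e = fixed-solve b≢𝟏 k∈ (Rad-j c) in
              extra (infinite e) (vertical-infinite c≢𝟎 z∈)
    ... | yes b≡𝟏 with k ≈? 0#
    -- The slope k = `j i` selects the pseudoline whose segment over (0:1:0) is x = z + `j i`.
    ...   | no k≉0 = contains {i = zero} {i′ = suc (proj₁ (Rad⇒j k∈))} (λ ())
            base-point record
            { point = λ d → j d + j i , 1# , j d
            ; on = λ d → infinite (trans (+-comm _ _) (+-cong (sym k≈ji)
                (sym (trans (*-congʳ-rad b≡𝟏 (Rad-j d)) (*-identityˡ _)))))
            ; in𝓛 = λ d → vertical-infinite i≢𝟎 (Rad-j d)
            ; injective = λ (_ , _ , e) → j-injective e
            }
      where
      i = proj₁ (Rad⇒j k∈)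
      k≈ji = proj₂ (Rad⇒j k∈)
      i≢𝟎 : i ≢ 𝟎
      i≢𝟎 i≡𝟎 = k≉0 (trans k≈ji (trans (reflexive (≡.cong j i≡𝟎)) j𝟎≈0))
    ...   | yes k≈0 with expansion b≡𝟏
    ...     | a , b≈ with a Fin.≟ 𝟎
    -- The slope θ of the pseudoline over x = z pays off here: its segment over (1:a:1) lies on x =
    -- T 1 + `j a`, so every a ≠ 0 is served.
    ...       | no a≢𝟎 = contains {i = zero} {i′ = suc 𝟏} (λ ()) base-point record
                { point = λ d → T 𝟏 + θ * (T a + j d) , T a + j d , 1#
                ; on = λ d → affine (trans (+-congˡ (*-expansion θ∈rad (T a) d)) (trans (sym b≈)
                    (sym (trans (+-congʳ (trans (*-congʳ k≈0) (zeroˡ _))) (+-identityˡ b)))))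
                ; in𝓛 = λ d → vertical-affine 𝟏≢𝟎 (λ e → a≢𝟎 (≡.trans (≡.sym (ρ-expansion a d)) e)) (λ _ → ≡.refl)
                ; injective = λ (_ , e , _) → +j-injective e
                }
    -- Only x = z itself remains, and the turned segment of the pseudoline over y = z lies on it.
    ...       | yes a≡𝟎 = contains {i = zero} {i′ = suc 𝟎} (λ ()) base-point record
                { point = λ d → 1# , T 𝟏 + j d , 1#
                ; on = λ d → affine (sym (trans (+-cong (trans (*-congʳ k≈0) (zeroˡ _))
                    (trans b≈ (trans (+-cong T-1 (trans (reflexive (≡.cong j a≡𝟎)) j𝟎≈0)) (+-identityʳ 1#))))
                    (+-identityˡ 1#)))
                ; in𝓛 = λ d → horizontal-turned (ρ-expansion 𝟏 d)
                ; injective = λ (_ , e , _) → +j-injective e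
                }

  module Infinite (k l : Carrier) (k∈ : Rad k) (l∈ : Rad l) where

    On : Carrierᴹ → Set ℓ
    On (x , y , z) = z ≈ k * x + l * y

    -- Over z = 0 all segments have direction y = z or x = z, so this line crosses one segment of
    -- every pseudoline.
    blocked : Blocked On
    blocked = transversal meets
      where
      on-slope : ∀ {y} → Rad y → On (1# , y , k)
      on-slope y∈ = sym (trans (+-cong (*-identityʳ k) (rad*rad l∈ y∈)) (+-identityʳ k))
      meets : ∀ i → Extra i On
      meets zero = extra (on-slope k∈) (base-infinite k∈)
      meets (suc c) with c Fin.≟ 𝟎
      ... | yes ≡.refl = extra (on-slope (Rad-+ k∈ θ∈rad)) (horizontal-infinite k∈)
      ... | no c≢𝟎 = extra (sym (trans (+-cong (rad*rad k∈ (Rad-+ l∈ (Rad-j c))) (*-identityʳ l)) (+-identityˡ l)))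
              (vertical-infinite c≢𝟎 l∈)

-- Lines and points in coordinates

module Geometry {R : Ring c ℓ} {q : ℕ} (chain : Chain R q) where
  open Ring R hiding (zero)
  open RingProperties R
  open Chain chain
  open Residues chain
  open Lines chain
  open PHG R
  open RightModule R³
    using (_≈ᴹ_; Carrierᴹ; ≈ᴹ-sym; ≈ᴹ-trans; ≈ᴹ-refl; ≈ᴹ-setoid; _+ᴹ_; _*ᵣ_; 0ᴹ; +ᴹ-cong; *ᵣ-cong; *ᵣ-zeroʳ;
           *ᵣ-distribˡ; *ᵣ-distribʳ; *ᵣ-assoc; +ᴹ-identityʳ; +ᴹ-comm; +ᴹ-assoc)

  π : Fin 3 → Carrierᴹ → Carrier
  π zero             (x , _ , _) = x
  π (suc zero)       (_ , y , _) = y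
  π (suc (suc zero)) (_ , _ , z) = z

  π-cong : ∀ i {v w} → v ≈ᴹ w → π i v ≈ π i w
  π-cong zero             (e , _ , _) = e
  π-cong (suc zero)       (_ , e , _) = e
  π-cong (suc (suc zero)) (_ , _ , e) = e

  π-+ : ∀ i v w → π i (v +ᴹ w) ≈ π i v + π i w
  π-+ zero             v w = refl
  π-+ (suc zero)       v w = refl
  π-+ (suc (suc zero)) v w = refl

  π-* : ∀ i v r → π i (v *ᵣ r) ≈ π i v * r
  π-* zero             v r = refl
  π-* (suc zero)       v r = refl
  π-* (suc (suc zero)) v r = refl

  FaithfulVector : Carrierᴹ → Set (c ⊔ ℓ)
  FaithfulVector v = ∀ r → v *ᵣ r ≈ᴹ 0ᴹ → r ≈ 0#

  -- A vector with all coordinates radical is annihilated by θ.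
  unit-coordinate : ∀ v → FaithfulVector v → ∃ λ i → ρ (π i v) ≢ 𝟎
  unit-coordinate v faithful with Fin.any? (λ i → Dec.¬? (ρ (π i v) Fin.≟ 𝟎))
  ... | yes found = found
  ... | no none = ⊥-elim (θ≉0 (faithful θ
          (rad*rad (v∈ zero) θ∈rad , rad*rad (v∈ (suc zero)) θ∈rad , rad*rad (v∈ (suc (suc zero))) θ∈rad)))
    where
    v∈ : ∀ i → Rad (π i v)
    v∈ i = Dec.decidable-stable (ρ (π i v) Fin.≟ 𝟎) λ v∉ → none (i , v∉)

  module _ (N : Submodule R³) where
    open Submodule N using (resp; +-closed; *-closed)

    record FreePair (u v : Carrierᴹ) : Set (c ⊔ ℓ) where
      field
        u∈          : mem N u
        v∈          : mem N v
        spanning    : ∀ {x} → mem N x → ∃ λ r → ∃ λ s → x ≈ᴹ u *ᵣ r +ᴹ v *ᵣ s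
        independent : ∀ r s → u *ᵣ r +ᴹ v *ᵣ s ≈ᴹ 0ᴹ → r ≈ 0# × s ≈ 0#

      faithfulˡ : FaithfulVector u
      faithfulˡ r ur≈0 = proj₁ (independent r 0#
        (≈ᴹ-trans (+ᴹ-cong ur≈0 (*ᵣ-zeroʳ v)) (+ᴹ-identityʳ 0ᴹ)))

    swap : ∀ {u v} → FreePair u v → FreePair v u
    swap {u} {v} P = record
      { u∈ = v∈
      ; v∈ = u∈
      ; spanning = λ x∈ → let r , s , e = spanning x∈ in s , r , ≈ᴹ-trans e (+ᴹ-comm _ _)
      ; independent = λ r s e → let s≈0 , r≈0 = independent s r (≈ᴹ-trans (+ᴹ-comm _ _) e) in r≈0 , s≈0
      }
      where open FreePair P

    scale : ∀ {u v a a⁻¹} → a * a⁻¹ ≈ 1# → a⁻¹ * a ≈ 1# → FreePair u v → FreePair (u *ᵣ a⁻¹) v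
    scale {u} {v} {a} {a⁻¹} aa⁻¹ a⁻¹a P = record
      { u∈ = *-closed a⁻¹ u∈
      ; v∈ = v∈
      ; spanning = λ x∈ → let r , s , e = spanning x∈ in a * r , s ,
          ≈ᴹ-trans e (+ᴹ-cong (≈ᴹ-sym (≈ᴹ-trans (*ᵣ-assoc u a⁻¹ (a * r)) (*ᵣ-cong (≈ᴹ-refl {u}) (undo r)))) ≈ᴹ-refl)
      ; independent = λ r s e → let a⁻¹r≈0 , s≈0 = independent (a⁻¹ * r) s
                                      (≈ᴹ-trans (+ᴹ-cong (≈ᴹ-sym (*ᵣ-assoc u a⁻¹ r)) ≈ᴹ-refl) e)
          in trans (sym (trans (sym (*-assoc a a⁻¹ r)) (trans (*-congʳ aa⁻¹) (*-identityˡ r))))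
               (trans (*-congˡ a⁻¹r≈0) (zeroʳ a)) , s≈0
      }
      where
      open FreePair P
      undo : ∀ r → a⁻¹ * (a * r) ≈ r
      undo r = trans (sym (*-assoc a⁻¹ a r)) (trans (*-congʳ a⁻¹a) (*-identityˡ r))

    shear : ∀ {u v} t → FreePair u v → FreePair u (v +ᴹ u *ᵣ t)
    shear {u} {v} t P = record
      { u∈ = u∈
      ; v∈ = +-closed v∈ (*-closed t u∈)
      ; spanning = λ x∈ → let r , s , e = spanning x∈ in r - t * s , s , ≈ᴹ-trans e (≈ᴹ-trans
          (+ᴹ-cong (*ᵣ-cong (≈ᴹ-refl {u}) (sym (//-rightDividesˡ (t * s) r))) ≈ᴹ-refl)
          (≈ᴹ-sym (regroup (r - t * s) s)))
      ; independent = λ r s e → let r+ts≈0 , s≈0 = independent (r + t * s) s (≈ᴹ-trans (≈ᴹ-sym (regroup r s)) e)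
          in trans (sym (trans (+-congˡ (trans (*-congˡ s≈0) (zeroʳ t))) (+-identityʳ r))) r+ts≈0 , s≈0
      }
      where
      open FreePair P
      regroup : ∀ r s → u *ᵣ r +ᴹ (v +ᴹ u *ᵣ t) *ᵣ s ≈ᴹ u *ᵣ (r + t * s) +ᴹ v *ᵣ s
      regroup r s = begin
        u *ᵣ r +ᴹ (v +ᴹ u *ᵣ t) *ᵣ s            ≈⟨ +ᴹ-cong ≈ᴹ-refl (*ᵣ-distribʳ s v (u *ᵣ t)) ⟩
        u *ᵣ r +ᴹ (v *ᵣ s +ᴹ u *ᵣ t *ᵣ s)       ≈⟨ +ᴹ-cong ≈ᴹ-refl (+ᴹ-comm _ _) ⟩
        u *ᵣ r +ᴹ (u *ᵣ t *ᵣ s +ᴹ v *ᵣ s)       ≈⟨ +ᴹ-assoc _ _ _ ⟨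
        u *ᵣ r +ᴹ u *ᵣ t *ᵣ s +ᴹ v *ᵣ s         ≈⟨ +ᴹ-cong (+ᴹ-cong ≈ᴹ-refl (*ᵣ-assoc u t s)) ≈ᴹ-refl ⟩
        u *ᵣ r +ᴹ u *ᵣ (t * s) +ᴹ v *ᵣ s        ≈⟨ +ᴹ-cong (*ᵣ-distribˡ u r (t * s)) ≈ᴹ-refl ⟨
        u *ᵣ (r + t * s) +ᴹ v *ᵣ s              ∎
        where open SetoidReasoning ≈ᴹ-setoid

    record Reduced (i k : Fin 3) : Set (c ⊔ ℓ) where
      field
        {u v} : Carrierᴹ
        free  : FreePair u v
        uᵢ≈1  : π i u ≈ 1#
        uₖ≈0  : π k u ≈ 0#
        vᵢ≈0  : π i v ≈ 0#
        vₖ≈1  : π k v ≈ 1#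

    π-pivot : ∀ i u {a} → π i u * a ≈ 1# → π i (u *ᵣ a) ≈ 1#
    π-pivot i u e = trans (π-* i u _) e

    π-clear : ∀ i u v → π i u ≈ 1# → π i (v +ᴹ u *ᵣ - π i v) ≈ 0#
    π-clear i u v uᵢ≈1 = trans (π-+ i v _) (trans (+-congˡ (trans (π-* i u _)
      (trans (*-congʳ uᵢ≈1) (*-identityˡ _)))) (-‿inverseʳ _))

    π-shear : ∀ i u v {t} → π i u ≈ 0# → π i (v +ᴹ u *ᵣ t) ≈ π i v
    π-shear i u v uᵢ≈0 = trans (π-+ i v _) (trans (+-congˡ (trans (π-* i u _)
      (trans (*-congʳ uᵢ≈0) (zeroˡ _)))) (+-identityʳ _))

    -- Gaussian elimination by operations on the right: scale the first vector at a unit coordinate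
    -- i, clear i in the second, scale that at a unit coordinate k, clear k in the first.
    reduce : ∀ {u v} → FreePair u v → ∃ λ i → ∃ λ k → i ≢ k × Reduced i k
    reduce {u} {v} P₀ = i , k , i≢k , record
      { free = P₄
      ; uᵢ≈1 = trans (π-shear i v₂ u₁ v₂ᵢ≈0) u₁ᵢ≈1
      ; uₖ≈0 = π-clear k v₂ u₁ v₂ₖ≈1
      ; vᵢ≈0 = v₂ᵢ≈0
      ; vₖ≈1 = v₂ₖ≈1
      }
      where
      pivot = unit-coordinate u (FreePair.faithfulˡ P₀)
      i = proj₁ pivot
      u⁻¹ = unit (π i u) (proj₂ pivot)
      u₁ = u *ᵣ proj₁ u⁻¹
      u₁ᵢ≈1 : π i u₁ ≈ 1#
      u₁ᵢ≈1 = π-pivot i u (proj₁ (proj₂ u⁻¹))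
      P₁ : FreePair u₁ v
      P₁ = scale (proj₁ (proj₂ u⁻¹)) (proj₂ (proj₂ u⁻¹)) P₀
      v₁ = v +ᴹ u₁ *ᵣ - π i v
      P₂ : FreePair v₁ u₁
      P₂ = swap (shear (- π i v) P₁)
      v₁ᵢ≈0 : π i v₁ ≈ 0#
      v₁ᵢ≈0 = π-clear i u₁ v u₁ᵢ≈1
      pivot′ = unit-coordinate v₁ (FreePair.faithfulˡ P₂)
      k = proj₁ pivot′
      i≢k : i ≢ k
      i≢k i≡k = proj₂ pivot′ (≈0⇒Rad (≡.subst (λ l → π l v₁ ≈ 0#) i≡k v₁ᵢ≈0))
      v⁻¹ = unit (π k v₁) (proj₂ pivot′)
      v₂ = v₁ *ᵣ proj₁ v⁻¹
      v₂ₖ≈1 : π k v₂ ≈ 1#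
      v₂ₖ≈1 = π-pivot k v₁ (proj₁ (proj₂ v⁻¹))
      v₂ᵢ≈0 : π i v₂ ≈ 0#
      v₂ᵢ≈0 = trans (π-* i v₁ _) (trans (*-congʳ v₁ᵢ≈0) (zeroˡ _))
      P₃ : FreePair v₂ u₁
      P₃ = scale (proj₁ (proj₂ v⁻¹)) (proj₂ (proj₂ v⁻¹)) P₂
      P₄ : FreePair (u₁ +ᴹ v₂ *ᵣ - π k u₁) v₂
      P₄ = swap (shear (- π k u₁) P₃)

    module _ {i k} (red : Reduced i k) where
      open Reduced red
      open FreePair free

      private
        π-combination : ∀ l r s → π l (u *ᵣ r +ᴹ v *ᵣ s) ≈ π l u * r + π l v * s
        π-combination l r s = trans (π-+ l _ _) (+-cong (π-* l u r) (π-* l v s))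

        π-first : ∀ r s → π i (u *ᵣ r +ᴹ v *ᵣ s) ≈ r
        π-first r s = trans (π-combination i r s) (trans (+-cong
          (trans (*-congʳ uᵢ≈1) (*-identityˡ r)) (trans (*-congʳ vᵢ≈0) (zeroˡ s))) (+-identityʳ r))

        π-second : ∀ r s → π k (u *ᵣ r +ᴹ v *ᵣ s) ≈ s
        π-second r s = trans (π-combination k r s) (trans (+-cong
          (trans (*-congʳ uₖ≈0) (zeroˡ r)) (trans (*-congʳ vₖ≈1) (*-identityˡ s))) (+-identityˡ s))

      reduced⇒equation : ∀ l {x} → mem N x → π l x ≈ π l u * π i x + π l v * π k x
      reduced⇒equation l {x} x∈ = let r , s , e = spanning x∈ in
        trans (π-cong l e) (trans (π-combination l r s) (+-cong
          (*-congˡ (trans (sym (π-first r s)) (π-cong i (≈ᴹ-sym e))))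
          (*-congˡ (trans (sym (π-second r s)) (π-cong k (≈ᴹ-sym e))))))

      -- `extensional` says that i, k and l are all three coordinates; each caller supplies it by
      -- permuting a triple.
      equation⇒reduced : ∀ l → (∀ {x y} → π i x ≈ π i y → π k x ≈ π k y → π l x ≈ π l y → x ≈ᴹ y) →
                         ∀ {x} → π l x ≈ π l u * π i x + π l v * π k x → mem N x
      equation⇒reduced l extensional {x} e = resp
        (extensional (π-first _ _) (π-second _ _) (trans (π-combination l _ _) (sym e)))
        (+-closed (*-closed (π i x) u∈) (*-closed (π k x) v∈))

    -- Solving for y whenever its coefficient allows, otherwise for x, leaves radical coefficients
    -- in the other two shapes.
    data Equation : Set (c ⊔ ℓ) where
      oblique  : ∀ m b → (∀ {v} → mem N v → Oblique.On m b v) → (∀ {v} → Oblique.On m b v → mem N v) → Equation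
      steep    : ∀ k b k∈ → (∀ {v} → mem N v → Steep.On k b k∈ v) → (∀ {v} → Steep.On k b k∈ v → mem N v) → Equation
      infinite : ∀ k l k∈ l∈ → (∀ {v} → mem N v → Infinite.On k l k∈ l∈ v) →
                 (∀ {v} → Infinite.On k l k∈ l∈ v → mem N v) → Equation

    -- Coefficients stay on the left, since R need not commute. This direction needs a⁻¹a = 1, its
    -- converse `restore` needs aa⁻¹ = 1.
    isolate : ∀ {a a⁻¹ b p s t} → a⁻¹ * a ≈ 1# → p ≈ a * s + b * t → s ≈ a⁻¹ * p + - (a⁻¹ * b) * t
    isolate {a} {a⁻¹} {b} {p} {s} {t} a⁻¹a e = sym (begin
      a⁻¹ * p + - (a⁻¹ * b) * t                       ≈⟨ +-cong (*-congˡ e) (sym (-‿distribˡ-* (a⁻¹ * b) t)) ⟩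
      a⁻¹ * (a * s + b * t) - a⁻¹ * b * t             ≈⟨ +-congʳ (distribˡ a⁻¹ _ _) ⟩
      a⁻¹ * (a * s) + a⁻¹ * (b * t) - a⁻¹ * b * t     ≈⟨ +-congʳ (+-cong (sym (*-assoc a⁻¹ a s)) (sym (*-assoc a⁻¹ b t))) ⟩
      a⁻¹ * a * s + a⁻¹ * b * t - a⁻¹ * b * t         ≈⟨ //-rightDividesʳ (a⁻¹ * b * t) _ ⟩
      a⁻¹ * a * s                                     ≈⟨ trans (*-congʳ a⁻¹a) (*-identityˡ s) ⟩
      s                                               ∎)
      where open SetoidReasoning setoid

    restore : ∀ {a a⁻¹ b p s t} → a * a⁻¹ ≈ 1# → s ≈ a⁻¹ * p + - (a⁻¹ * b) * t → p ≈ a * s + b * t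
    restore {a} {a⁻¹} {b} {p} {s} {t} aa⁻¹ e = sym (begin
      a * s + b * t                                   ≈⟨ +-congʳ (*-congˡ e) ⟩
      a * (a⁻¹ * p + - (a⁻¹ * b) * t) + b * t         ≈⟨ +-congʳ (distribˡ a _ _) ⟩
      a * (a⁻¹ * p) + a * (- (a⁻¹ * b) * t) + b * t   ≈⟨ +-congʳ (+-cong (undo p)
        (trans (*-congˡ (sym (-‿distribˡ-* (a⁻¹ * b) t))) (trans (sym (-‿distribʳ-* a _))
          (-‿cong (trans (*-congˡ (*-assoc a⁻¹ b t)) (undo (b * t))))))) ⟩
      p - b * t + b * t                               ≈⟨ //-rightDividesˡ (b * t) p ⟩
      p                                               ∎)
      where
      open SetoidReasoning setoid
      undo : ∀ r → a * (a⁻¹ * r) ≈ r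
      undo r = trans (sym (*-assoc a a⁻¹ r)) (trans (*-congʳ aa⁻¹) (*-identityˡ r))

    solve-x : ∀ α β → (∀ {x y z} → mem N (x , y , z) → x ≈ α * y + β * z) →
              (∀ {x y z} → x ≈ α * y + β * z → mem N (x , y , z)) → Equation
    solve-x α β to from with ρ α Fin.≟ 𝟎
    ... | yes α∈ = steep α β α∈ to from
    ... | no α∉ = let _ , αα⁻¹ , α⁻¹α = unit α α∉ in
      oblique _ _ (λ v∈ → isolate α⁻¹α (to v∈)) (λ e → from (restore αα⁻¹ e))

    solve-z : ∀ α β → (∀ {x y z} → mem N (x , y , z) → z ≈ α * x + β * y) →
              (∀ {x y z} → z ≈ α * x + β * y → mem N (x , y , z)) → Equation
    solve-z α β to from with ρ α Fin.≟ 𝟎 | ρ β Fin.≟ 𝟎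
    ... | yes α∈ | yes β∈ = infinite α β α∈ β∈ to from
    ... | no α∉ | _ = let _ , αα⁻¹ , α⁻¹α = unit α α∉ in
      solve-x _ _ (λ v∈ → trans (isolate α⁻¹α (to v∈)) (+-comm _ _))
        (λ e → from (restore αα⁻¹ (trans e (+-comm _ _))))
    ... | yes _ | no β∉ = let _ , ββ⁻¹ , β⁻¹β = unit β β∉ in
      oblique _ _ (λ v∈ → trans (isolate β⁻¹β (trans (to v∈) (+-comm _ _))) (+-comm _ _))
        (λ e → from (trans (restore ββ⁻¹ (trans e (+-comm _ _))) (+-comm _ _)))

    equation : IsFreeOfRank 2 N → Equation
    equation (basis , isBasis) = fromReduced (reduce free₀)
      where
      open IsBasis isBasis
      free₀ : FreePair (basis zero) (basis (suc zero))
      free₀ = record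
        { u∈ = inside zero
        ; v∈ = inside (suc zero)
        ; spanning = λ x∈ → let r , e = spanning x∈ in r zero , r (suc zero) ,
            ≈ᴹ-trans e (+ᴹ-cong (≈ᴹ-refl {basis zero *ᵣ r zero}) (+ᴹ-identityʳ _))
        ; independent = λ r s e → let indep = independent (λ { zero → r ; (suc _) → s })
                                        (≈ᴹ-trans (+ᴹ-cong (≈ᴹ-refl {basis zero *ᵣ r}) (+ᴹ-identityʳ _)) e)
            in indep zero , indep (suc zero)
        }
      fromReduced : (∃ λ i → ∃ λ k → i ≢ k × Reduced i k) → Equation
      fromReduced (zero , zero , ≢ , _) = ⊥-elim (≢ ≡.refl)
      fromReduced (suc zero , suc zero , ≢ , _) = ⊥-elim (≢ ≡.refl)
      fromReduced (suc (suc zero) , suc (suc zero) , ≢ , _) = ⊥-elim (≢ ≡.refl)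
      fromReduced (zero , suc zero , _ , red) = solve-z _ _ (reduced⇒equation red (suc (suc zero)))
        (equation⇒reduced red (suc (suc zero)) λ e₁ e₂ e₃ → e₁ , e₂ , e₃)
      fromReduced (suc zero , zero , _ , red) = solve-z _ _
        (λ v∈ → trans (reduced⇒equation red (suc (suc zero)) v∈) (+-comm _ _))
        (λ e → equation⇒reduced red (suc (suc zero)) (λ e₂ e₁ e₃ → e₁ , e₂ , e₃) (trans e (+-comm _ _)))
      fromReduced (zero , suc (suc zero) , _ , red) = oblique _ _ (reduced⇒equation red (suc zero))
        (equation⇒reduced red (suc zero) λ e₁ e₃ e₂ → e₁ , e₂ , e₃)
      fromReduced (suc (suc zero) , zero , _ , red) = oblique _ _
        (λ v∈ → trans (reduced⇒equation red (suc zero) v∈) (+-comm _ _))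
        (λ e → equation⇒reduced red (suc zero) (λ e₃ e₁ e₂ → e₁ , e₂ , e₃) (trans e (+-comm _ _)))
      fromReduced (suc zero , suc (suc zero) , _ , red) = solve-x _ _ (reduced⇒equation red zero)
        (equation⇒reduced red zero λ e₂ e₃ e₁ → e₁ , e₂ , e₃)
      fromReduced (suc (suc zero) , suc zero , _ , red) = solve-x _ _
        (λ v∈ → trans (reduced⇒equation red zero v∈) (+-comm _ _))
        (λ e → equation⇒reduced red zero (λ e₃ e₂ e₁ → e₁ , e₂ , e₃) (trans e (+-comm _ _)))

-- Normalised vectors as coordinates of points.

module Points {R : Ring c ℓ} {q : ℕ} (chain : Chain R q) where
  open Ring R hiding (zero)
  open Chain chain
  open Residues chain
  open Pseudolines chain using (Index; Rad-resp; Rad⇒≉1)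
  open Lines chain
  open Geometry chain
  open PHG R
  open RightModule R³
    using (_≈ᴹ_; Carrierᴹ; ≈ᴹ-sym; ≈ᴹ-trans; ≈ᴹ-refl; _*ᵣ_; +ᴹ-cong; *ᵣ-cong; *ᵣ-zeroʳ;
           *ᵣ-distribˡ; *ᵣ-assoc; *ᵣ-identityʳ; +ᴹ-identityʳ)

  -- The first unit among z, x, y, in this order, is scaled to 1. This picks one generator of every
  -- point.
  data Normal : Carrierᴹ → Set (c ⊔ ℓ) where
    affine   : ∀ {x y z} → z ≈ 1# → Normal (x , y , z)
    slope    : ∀ {x y z} → x ≈ 1# → Rad z → Normal (x , y , z)
    vertical : ∀ {x y z} → y ≈ 1# → Rad x → Rad z → Normal (x , y , z)

  private
    r≈1 : ∀ {x y r} → x ≈ 1# → y ≈ 1# → y ≈ x * r → r ≈ 1#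
    r≈1 x≈1 y≈1 e = trans (sym (trans (*-congʳ x≈1) (*-identityˡ _))) (trans (sym e) y≈1)

    r∈ : ∀ {x y r} → x ≈ 1# → Rad y → y ≈ x * r → Rad r
    r∈ x≈1 y∈ e = Rad-resp (trans e (trans (*-congʳ x≈1) (*-identityˡ _))) y∈

    absurdˡ : ∀ {x y r} → Rad x → y ≈ 1# → y ≈ x * r → ⊥
    absurdˡ {r = r} x∈ y≈1 e = Rad⇒≉1 (Rad-resp (sym e) (Rad-* r x∈)) y≈1

    absurdʳ : ∀ {x y r} → Rad r → y ≈ 1# → y ≈ x * r → ⊥
    absurdʳ {x} r∈ y≈1 e = Rad⇒≉1 (Rad-resp (sym e) (Rad-*ˡ x r∈)) y≈1

  -- Comparing the coordinate that is 1 gives r = 1 for equal shapes; for different shapes a radical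
  -- element would equal 1.
  normal-unique : ∀ {v w r} → Normal v → Normal w → w ≈ᴹ v *ᵣ r → v ≈ᴹ w
  normal-unique {v} {w} {r} Nv Nw e = ≈ᴹ-sym (≈ᴹ-trans e
    (≈ᴹ-trans (*ᵣ-cong (≈ᴹ-refl {v}) (factor Nv Nw e)) (*ᵣ-identityʳ v)))
    where
    factor : ∀ {v w} → Normal v → Normal w → w ≈ᴹ v *ᵣ r → r ≈ 1#
    factor (affine z≈1)       (affine z′≈1)      (_ , _ , e) = r≈1 z≈1 z′≈1 e
    factor (slope _ z∈)       (affine z′≈1)      (_ , _ , e) = ⊥-elim (absurdˡ z∈ z′≈1 e)
    factor (vertical _ _ z∈)  (affine z′≈1)      (_ , _ , e) = ⊥-elim (absurdˡ z∈ z′≈1 e)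
    factor (affine z≈1)       (slope x′≈1 z′∈)   (e , _ , e′) = ⊥-elim (absurdʳ (r∈ z≈1 z′∈ e′) x′≈1 e)
    factor (slope x≈1 _)      (slope x′≈1 _)     (e , _ , _) = r≈1 x≈1 x′≈1 e
    factor (vertical _ x∈ _)  (slope x′≈1 _)     (e , _ , _) = ⊥-elim (absurdˡ x∈ x′≈1 e)
    factor (affine z≈1)       (vertical y′≈1 _ z′∈) (_ , e , e′) = ⊥-elim (absurdʳ (r∈ z≈1 z′∈ e′) y′≈1 e)
    factor (slope x≈1 _)      (vertical y′≈1 x′∈ _) (e′ , e , _) = ⊥-elim (absurdʳ (r∈ x≈1 x′∈ e′) y′≈1 e)
    factor (vertical y≈1 _ _) (vertical y′≈1 _ _)   (_ , e , _) = r≈1 y≈1 y′≈1 e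

  normal⇒faithful : ∀ {v} → Normal v → FaithfulVector v
  normal⇒faithful (affine z≈1) r (_ , _ , e) = trans (sym (trans (*-congʳ z≈1) (*-identityˡ r))) e
  normal⇒faithful (slope x≈1 _) r (e , _ , _) = trans (sym (trans (*-congʳ x≈1) (*-identityˡ r))) e
  normal⇒faithful (vertical y≈1 _ _) r (_ , e , _) = trans (sym (trans (*-congʳ y≈1) (*-identityˡ r))) e

  normalise : ∀ v → FaithfulVector v → ∃ λ a → ∃ λ a⁻¹ → a⁻¹ * a ≈ 1# × Normal (v *ᵣ a⁻¹)
  normalise v@(x , y , z) faithful with ρ z Fin.≟ 𝟎
  ... | no z∉ = let a , za , az = unit z z∉ in z , a , az , affine za
  ... | yes z∈ with ρ x Fin.≟ 𝟎
  ...   | no x∉ = let a , xa , ax = unit x x∉ in x , a , ax , slope xa (Rad-* a z∈)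
  ...   | yes x∈ = let a , ya , ay = unit y y∉ in y , a , ay , vertical ya (Rad-* a x∈) (Rad-* a z∈)
    where
    y∉ : ρ y ≢ 𝟎
    y∉ y∈ with unit-coordinate v faithful
    ... | zero , x∉           = x∉ x∈
    ... | suc zero , y∉       = y∉ y∈
    ... | suc (suc zero) , z∉ = z∉ z∈

  infix 4 _≈ᴹ?_

  _≈ᴹ?_ : ∀ v w → Dec (v ≈ᴹ w)
  (x , y , z) ≈ᴹ? (x′ , y′ , z′) = (x ≈? x′) Dec.×-dec ((y ≈? y′) Dec.×-dec (z ≈? z′))

  span : Carrierᴹ → Submodule R³
  span v = record
    { mem = λ w → ∃ λ r → w ≈ᴹ v *ᵣ r
    ; mem? = λ w → search (λ e w≈ → ≈ᴹ-trans w≈ (*ᵣ-cong (≈ᴹ-refl {v}) e)) (λ r → w ≈ᴹ? v *ᵣ r)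
    ; resp = λ e (r , w≈) → r , ≈ᴹ-trans (≈ᴹ-sym e) w≈
    ; 0∈ = 0# , ≈ᴹ-sym (*ᵣ-zeroʳ v)
    ; +-closed = λ (r , e) (s , e′) → r + s , ≈ᴹ-trans (+ᴹ-cong e e′) (≈ᴹ-sym (*ᵣ-distribˡ v r s))
    ; *-closed = λ {w} s (r , e) → r * s , ≈ᴹ-trans (*ᵣ-cong e (refl {s})) (*ᵣ-assoc v r s)
    }

  point : ∀ v → Normal v → Point
  point v N = span v , (λ _ → v) , record
    { inside = λ _ → 1# , ≈ᴹ-sym (*ᵣ-identityʳ v)
    ; spanning = λ (r , e) → (λ _ → r) , ≈ᴹ-trans e (≈ᴹ-sym (+ᴹ-identityʳ _))
    ; independent = λ { r e zero → normal⇒faithful N (r zero) (≈ᴹ-trans (≈ᴹ-sym (+ᴹ-identityʳ _)) e) }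
    }

  record Normalisation (p : Point) : Set (c ⊔ ℓ) where
    field
      vector  : Carrierᴹ
      normal  : Normal vector
      inside  : mem (proj₁ p) vector
      spanned : ∀ {w} → mem (proj₁ p) w → ∃ λ r → w ≈ᴹ vector *ᵣ r

  normalisation′ : ∀ p → Normalisation p
  normalisation′ (N , basis , isBasis) = record
    { vector = v *ᵣ a⁻¹
    ; normal = proj₂ (proj₂ (proj₂ scaling))
    ; inside = Submodule.*-closed N a⁻¹ (inside zero)
    ; spanned = λ w∈ → let r , e = spanning w∈ in a * r zero , ≈ᴹ-trans e (≈ᴹ-trans (+ᴹ-identityʳ _)
        (≈ᴹ-sym (≈ᴹ-trans (*ᵣ-assoc v a⁻¹ _) (*ᵣ-cong (≈ᴹ-refl {v})
          (trans (sym (*-assoc a⁻¹ a _)) (trans (*-congʳ (proj₁ (proj₂ (proj₂ scaling)))) (*-identityˡ _)))))))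
    }
    where
    open IsBasis isBasis
    v = basis zero
    scaling = normalise v λ r e → independent (λ _ → r) (≈ᴹ-trans (+ᴹ-identityʳ _) e) zero
    a = proj₁ scaling
    a⁻¹ = proj₁ (proj₂ scaling)

  abstract
    normalisation : ∀ p → Normalisation p
    normalisation = normalisation′

  infix 4 _≈ᴾ_
  _≈ᴾ_ : Point → Point → Set (c ⊔ ℓ)
  _≈ᴾ_ = Setoid._≈_ points

  vec : Point → Carrierᴹ
  vec p = Normalisation.vector (normalisation p)

  vec-normal : ∀ p → Normal (vec p)
  vec-normal p = Normalisation.normal (normalisation p)

  vec-inside : ∀ p → mem (proj₁ p) (vec p)
  vec-inside p = Normalisation.inside (normalisation p)

  vec∈⇒⊆ : ∀ p (N : Submodule R³) → mem N (vec p) → mem (proj₁ p) ⊆ mem N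
  vec∈⇒⊆ p N v∈ w∈ = let r , e = Normalisation.spanned (normalisation p) w∈ in
    Submodule.resp N (≈ᴹ-sym e) (Submodule.*-closed N r v∈)

  vec-cong : ∀ {p p′} → p ≈ᴾ p′ → vec p ≈ᴹ vec p′
  vec-cong {p} {p′} (_ , ⊇) = let r , e = Normalisation.spanned (normalisation p) (⊇ (vec-inside p′)) in
    normal-unique (vec-normal p) (vec-normal p′) e

  vec-injective : ∀ {p p′} → vec p ≈ᴹ vec p′ → p ≈ᴾ p′
  vec-injective {p} {p′} e =
    vec∈⇒⊆ p (proj₁ p′) (Submodule.resp (proj₁ p′) (≈ᴹ-sym e) (vec-inside p′)) ,
    vec∈⇒⊆ p′ (proj₁ p) (Submodule.resp (proj₁ p) e (vec-inside p))

  vec-point : ∀ v (N : Normal v) → vec (point v N) ≈ᴹ v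
  vec-point v N = let r , e = vec-inside (point v N) in
    ≈ᴹ-sym (normal-unique N (vec-normal (point v N)) e)

  _≟ᴾ_ : ∀ p p′ → Dec (p ≈ᴾ p′)
  p ≟ᴾ p′ = Dec.map′ (λ (v∈ , v′∈) → vec∈⇒⊆ p (proj₁ p′) v∈ , vec∈⇒⊆ p′ (proj₁ p) v′∈)
    (λ (⊆ , ⊇) → ⊆ (vec-inside p) , ⊇ (vec-inside p′))
    (Submodule.mem? (proj₁ p′) (vec p) Dec.×-dec Submodule.mem? (proj₁ p) (vec p′))

  on? : ∀ p L → Dec (p on L)
  on? p (N , _) = Dec.map′ (λ v∈ {w} → vec∈⇒⊆ p N v∈ {w}) (λ p⊆ → p⊆ (vec-inside p)) (Submodule.mem? N (vec p))

  element : Fin q × Fin q → Carrier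
  element (a , d) = T a + j d

  element-surjective : ∀ x → ∃ λ e → x ≈ element e
  element-surjective x = let d , e = expansion {x} ≡.refl in (ρ x , d) , e

  element-injective : ∀ e e′ → element e ≈ element e′ → e ≡ e′
  element-injective (a , d) (a′ , d′) e with ≡.trans (≡.sym (ρ-expansion a d)) (≡.trans (ρ-cong e) (ρ-expansion a′ d′))
  ... | ≡.refl = ≡.cong (a ,_) (+j-injective e)

  Code : Set
  Code = ((Fin q × Fin q) × (Fin q × Fin q)) ⊎ ((Fin q × Fin q) × Fin q ⊎ Fin q × Fin q)

  decode : Code → Carrierᴹ
  decode (inj₁ (e , e′))        = element e , element e′ , 1#
  decode (inj₂ (inj₁ (e , d)))  = 1# , element e , j d
  decode (inj₂ (inj₂ (d , d′))) = j d , 1# , j d′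

  decode-normal : ∀ s → Normal (decode s)
  decode-normal (inj₁ _)               = affine refl
  decode-normal (inj₂ (inj₁ (_ , d)))  = slope refl (Rad-j d)
  decode-normal (inj₂ (inj₂ (d , d′))) = vertical refl (Rad-j d) (Rad-j d′)

  decode-injective : ∀ s s′ → decode s ≈ᴹ decode s′ → s ≡ s′
  decode-injective (inj₁ _) (inj₁ _) (e , e′ , _) =
    ≡.cong₂ (λ a b → inj₁ (a , b)) (element-injective _ _ e) (element-injective _ _ e′)
  decode-injective (inj₁ _) (inj₂ (inj₁ (_ , d))) (_ , _ , e) = ⊥-elim (Rad⇒≉1 (Rad-j d) (sym e))
  decode-injective (inj₁ _) (inj₂ (inj₂ (_ , d))) (_ , _ , e) = ⊥-elim (Rad⇒≉1 (Rad-j d) (sym e))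
  decode-injective (inj₂ (inj₁ (_ , d))) (inj₁ _) (_ , _ , e) = ⊥-elim (Rad⇒≉1 (Rad-j d) e)
  decode-injective (inj₂ (inj₂ (_ , d))) (inj₁ _) (_ , _ , e) = ⊥-elim (Rad⇒≉1 (Rad-j d) e)
  decode-injective (inj₂ (inj₁ _)) (inj₂ (inj₁ _)) (_ , e , e′) =
    ≡.cong₂ (λ a b → inj₂ (inj₁ (a , b))) (element-injective _ _ e) (j-injective e′)
  decode-injective (inj₂ (inj₁ _)) (inj₂ (inj₂ (d , _))) (e , _ , _) = ⊥-elim (Rad⇒≉1 (Rad-j d) (sym e))
  decode-injective (inj₂ (inj₂ (d , _))) (inj₂ (inj₁ _)) (e , _ , _) = ⊥-elim (Rad⇒≉1 (Rad-j d) e)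
  decode-injective (inj₂ (inj₂ _)) (inj₂ (inj₂ _)) (e , _ , e′) =
    ≡.cong₂ (λ a b → inj₂ (inj₂ (a , b))) (j-injective e) (j-injective e′)

  decode-surjective : ∀ {v} → Normal v → ∃ λ s → v ≈ᴹ decode s
  decode-surjective {x , y , z} (affine z≈1) =
    let e , x≈ = element-surjective x ; e′ , y≈ = element-surjective y in inj₁ (e , e′) , (x≈ , y≈ , z≈1)
  decode-surjective {x , y , z} (slope x≈1 z∈) =
    let e , y≈ = element-surjective y ; d , z≈ = Rad⇒j z∈ in inj₂ (inj₁ (e , d)) , (x≈1 , y≈ , z≈)
  decode-surjective {x , y , z} (vertical y≈1 x∈ z∈) =
    let d , x≈ = Rad⇒j x∈ ; d′ , z≈ = Rad⇒j z∈ in inj₂ (inj₂ (d , d′)) , (x≈ , y≈1 , z≈)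

  -- Only an upper bound of q² + q for the points of a line is needed, so the cover need not be
  -- injective.
  record Covered (L : Carrierᴹ → Set ℓ) : Set (c ⊔ ℓ) where
    field
      cover  : Index → Carrierᴹ
      covers : ∀ {v} → Normal v → L v → ∃ λ s → v ≈ᴹ cover s

  covered-oblique : ∀ m b → Covered (Oblique.On m b)
  covered-oblique m b = record { cover = cover ; covers = covers }
    where
    cover : Index → Carrierᴹ
    cover (inj₁ e) = element e , m * element e + b , 1#
    cover (inj₂ d) = 1# , m + b * j d , j d
    covers : ∀ {v} → Normal v → Oblique.On m b v → ∃ λ s → v ≈ᴹ cover s
    covers {x , y , z} (affine z≈1) v∈ = let e , x≈ = element-surjective x in inj₁ e ,
      (x≈ , trans v∈ (+-cong (*-congˡ x≈) (trans (*-congˡ z≈1) (*-identityʳ b))) , z≈1)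
    covers {x , y , z} (slope x≈1 z∈) v∈ = let d , z≈ = Rad⇒j z∈ in inj₂ d ,
      (x≈1 , trans v∈ (+-cong (trans (*-congˡ x≈1) (*-identityʳ m)) (*-congˡ z≈)) , z≈)
    covers (vertical y≈1 x∈ z∈) v∈ = ⊥-elim (Rad⇒≉1 (Rad-resp (sym v∈) (Rad-+ (Rad-*ˡ m x∈) (Rad-*ˡ b z∈))) y≈1)

  covered-steep : ∀ k b k∈ → Covered (Steep.On k b k∈)
  covered-steep k b k∈ = record { cover = cover ; covers = covers }
    where
    cover : Index → Carrierᴹ
    cover (inj₁ e) = k * element e + b , element e , 1#
    cover (inj₂ d) = k + b * j d , 1# , j d
    covers : ∀ {v} → Normal v → Steep.On k b k∈ v → ∃ λ s → v ≈ᴹ cover s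
    covers {x , y , z} (affine z≈1) v∈ = let e , y≈ = element-surjective y in inj₁ e ,
      (trans v∈ (+-cong (*-congˡ y≈) (trans (*-congˡ z≈1) (*-identityʳ b))) , y≈ , z≈1)
    covers {x , y , z} (slope x≈1 z∈) v∈ =
      ⊥-elim (Rad⇒≉1 (Rad-resp (sym v∈) (Rad-+ (Rad-* y k∈) (Rad-*ˡ b z∈))) x≈1)
    covers {x , y , z} (vertical y≈1 x∈ z∈) v∈ = let d , z≈ = Rad⇒j z∈ in inj₂ d ,
      (trans v∈ (+-cong (trans (*-congˡ y≈1) (*-identityʳ k)) (*-congˡ z≈)) , y≈1 , z≈)

  covered-infinite : ∀ k l k∈ l∈ → Covered (Infinite.On k l k∈ l∈)
  covered-infinite k l k∈ l∈ = record { cover = cover ; covers = covers }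
    where
    cover : Index → Carrierᴹ
    cover (inj₁ e) = 1# , element e , k + l * element e
    cover (inj₂ d) = j d , 1# , k * j d + l
    covers : ∀ {v} → Normal v → Infinite.On k l k∈ l∈ v → ∃ λ s → v ≈ᴹ cover s
    covers {x , y , z} (affine z≈1) v∈ =
      ⊥-elim (Rad⇒≉1 (Rad-resp (sym v∈) (Rad-+ (Rad-* x k∈) (Rad-* y l∈))) z≈1)
    covers {x , y , z} (slope x≈1 z∈) v∈ = let e , y≈ = element-surjective y in inj₁ e ,
      (x≈1 , y≈ , trans v∈ (+-cong (trans (*-congˡ x≈1) (*-identityʳ k)) (*-congˡ y≈)))
    covers {x , y , z} (vertical y≈1 x∈ z∈) v∈ = let d , x≈ = Rad⇒j x∈ in inj₂ d ,
      (x≈ , y≈1 , trans v∈ (+-cong (*-congˡ x≈) (trans (*-congˡ y≈1) (*-identityʳ l))))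

open import Data.Nat.Base using (_+_; _*_; _∸_; _^_; _≤_)

-- Counting

length-filter-¬ : ∀ {A : Set c} {P : Pred A ℓ₁} (P? : Decidable P) xs →
                  length (filter P? xs) + length (filter (Dec.¬? ∘ P?) xs) ≡ length xs
length-filter-¬ P? [] = ≡.refl
length-filter-¬ P? (x ∷ xs) with does (P? x)
... | true  = ≡.cong suc (length-filter-¬ P? xs)
... | false = ≡.trans (ℕ.+-suc _ _) (≡.cong suc (length-filter-¬ P? xs))

module Counting (S : Setoid c ℓ) where
  open Setoid S renaming (Carrier to A)
  open Membership S using (_∈_; _∉_)
  open UniqueSetoid S using (Unique)

  lookup-injective : ∀ {xs} → Unique xs → ∀ i k → lookup xs i ≈ lookup xs k → i ≡ k
  lookup-injective {x ∷ xs} (x≉ ∷ u) i k = go i k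
    where
    x≉lookup : ∀ i → ¬ x ≈ lookup xs i
    x≉lookup i = All.lookupₛ S (λ y≈z x≉y x≈z → x≉y (trans x≈z (sym y≈z))) x≉ (∈.∈-lookup S xs i)
    go : ∀ i k → lookup (x ∷ xs) i ≈ lookup (x ∷ xs) k → i ≡ k
    go zero    zero    _ = ≡.refl
    go zero    (suc k) e = ⊥-elim (x≉lookup k e)
    go (suc i) zero    e = ⊥-elim (x≉lookup i (sym e))
    go (suc i) (suc k) e = ≡.cong suc (lookup-injective u i k e)

  -- The pigeonhole principle. `C` is a relation, so a code need only be exhibited for the members
  -- of the list.
  length≤ : ∀ {n} (C : A → Fin n → Set ℓ₁) → (∀ {x y k} → C x k → C y k → x ≈ y) →
            ∀ {xs} → Unique xs → (∀ {x} → x ∈ xs → ∃ (C x)) → length xs ≤ n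
  length≤ C inj {xs} u code = Fin.injective⇒≤ {f = λ i → proj₁ (code (∈.∈-lookup S xs i))} λ {i} {k} e →
    lookup-injective u i k (inj (proj₂ (code (∈.∈-lookup S xs i)))
      (≡.subst (C (lookup xs k)) (≡.sym e) (proj₂ (code (∈.∈-lookup S xs k)))))

  module Subset (_≟_ : ∀ x y → Dec (x ≈ y)) {ps : List A} (enumeration : Enumerates.IsEnumeration S ps)
                (ps! : Unique ps) (ks : List A) (ks! : Unique ks) where
    private
      decSetoid : DecSetoid _ _
      decSetoid = record { isDecEquivalence = record { isEquivalence = isEquivalence ; _≟_ = _≟_ } }

    open DecMembership decSetoid using (_∈?_)

    ∈ks-resp : ∀ {x y} → x ≈ y → x ∈ ks → y ∈ ks
    ∈ks-resp e = ∈.∈-resp-≈ S e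

    indicator : S ⟶ₛ ≡.setoid ℕ
    indicator = record { to = λ x → if does (x ∈? ks) then 1 else 0 ; cong = cong }
      where
      cong : ∀ {x y} → x ≈ y → (if does (x ∈? ks) then 1 else 0) ≡ (if does (y ∈? ks) then 1 else 0)
      cong {x} {y} e with x ∈? ks | y ∈? ks
      ... | yes _  | yes _  = ≡.refl
      ... | no _   | no _   = ≡.refl
      ... | yes x∈ | no y∉  = ⊥-elim (y∉ (∈ks-resp e x∈))
      ... | no x∉  | yes y∈ = ⊥-elim (x∉ (∈ks-resp (sym e) y∈))

    open Func indicator renaming (to to 𝟙)

    indicator-0∨1 : ∀ x → 𝟙 x ≡ 0 ⊎ 𝟙 x ≡ 1
    indicator-0∨1 x with does (x ∈? ks)
    ... | true  = inj₂ ≡.refl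
    ... | false = inj₁ ≡.refl

    sum-inside : ∀ xs → (∀ {x} → x ∈ xs → x ∈ ks) → sum (map 𝟙 xs) ≡ length xs
    sum-inside [] _ = ≡.refl
    sum-inside (x ∷ xs) inside with x ∈? ks
    ... | yes _  = ≡.cong suc (sum-inside xs (inside ∘ there))
    ... | no x∉  = ⊥-elim (x∉ (inside (here refl)))

    sum-outside : ∀ xs → (∀ {x} → x ∈ xs → x ∉ ks) → sum (map 𝟙 xs) ≡ 0
    sum-outside [] _ = ≡.refl
    sum-outside (x ∷ xs) outside with x ∈? ks
    ... | yes x∈ = ⊥-elim (outside (here refl) x∈)
    ... | no _   = sum-outside xs (outside ∘ there)

    rest : List A
    rest = filter (Dec.¬? ∘ (_∈? ks)) ps

    ∉ks-resp : (_∉ ks) Respects _≈_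
    ∉ks-resp e x∉ y∈ = x∉ (∈ks-resp (sym e) y∈)

    rest⇒∉ks : ∀ {x} → x ∈ rest → x ∉ ks
    rest⇒∉ks = proj₂ ∘ ∈.∈-filter⁻ S (Dec.¬? ∘ (_∈? ks)) ∉ks-resp {xs = ps}

    all! : Unique (ks ++ rest)
    all! = Unique.++⁺ S ks! (Unique.filter⁺ S _ ps!) λ (x∈ , x∈rest) → rest⇒∉ks x∈rest x∈

    all-enumerates : ∀ x → x ∈ ks ++ rest
    all-enumerates x with x ∈? ks
    ... | yes x∈ = ∈.∈-++⁺ˡ S x∈
    ... | no x∉  = ∈.∈-++⁺ʳ S ks (∈.∈-filter⁺ S (Dec.¬? ∘ (_∈? ks)) ∉ks-resp (enumeration x) x∉)

    -- The enumeration lists the chosen elements first, so the sum splits into ones followed by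
    -- zeros.
    sumsTo : SumsTo S indicator (length ks)
    sumsTo = ks ++ rest , all-enumerates , all! , (begin
      sum (map 𝟙 (ks ++ rest))             ≡⟨ ≡.cong sum (List.map-++ 𝟙 ks rest) ⟩
      sum (map 𝟙 ks ++ map 𝟙 rest)         ≡⟨ sum-++ (map 𝟙 ks) (map 𝟙 rest) ⟩
      sum (map 𝟙 ks) + sum (map 𝟙 rest)    ≡⟨ ≡.cong₂ _+_ (sum-inside ks λ x∈ → x∈) (sum-outside rest rest⇒∉ks) ⟩
      length ks + 0                        ≡⟨ ℕ.+-identityʳ _ ⟩
      length ks                            ∎)
      where open ≡.≡-Reasoning

    module _ {P : Pred A ℓ₁} (P? : Decidable P) (P-resp : P Respects _≈_) where

      private
        T : Setoid (c ⊔ ℓ₁) ℓ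
        T = On.setoid {B = Σ A P} S proj₁

      attach : List A → List (Σ A P)
      attach [] = []
      attach (x ∷ xs) with P? x
      ... | yes px = (x , px) ∷ attach xs
      ... | no _   = attach xs

      map-proj₁-attach : ∀ xs → map proj₁ (attach xs) ≡ filter P? xs
      map-proj₁-attach [] = ≡.refl
      map-proj₁-attach (x ∷ xs) with P? x
      ... | yes _ = ≡.cong (x ∷_) (map-proj₁-attach xs)
      ... | no _  = map-proj₁-attach xs

      -- An element of the subtype carries a proof, so the filtered enumeration is rebuilt with
      -- proofs attached; projecting these away gives back `filter` and the previous computation.
      sumsTo-sub : (𝟙′ : T ⟶ₛ ≡.setoid ℕ) → (∀ t → Func.to 𝟙′ t ≡ 𝟙 (proj₁ t)) →
                   SumsTo T 𝟙′ (length (filter P? ks))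
      sumsTo-sub 𝟙′ 𝟙′≡ = attach (ks ++ rest) , enumerates , unique , (begin
        sum (map (Func.to 𝟙′) (attach (ks ++ rest)))              ≡⟨ ≡.cong sum (List.map-cong 𝟙′≡ (attach (ks ++ rest))) ⟩
        sum (map (𝟙 ∘ proj₁) (attach (ks ++ rest)))               ≡⟨ ≡.cong sum (List.map-∘ (attach (ks ++ rest))) ⟩
        sum (map 𝟙 (map proj₁ (attach (ks ++ rest))))             ≡⟨ ≡.cong (sum ∘ map 𝟙) (map-proj₁-attach (ks ++ rest)) ⟩
        sum (map 𝟙 (filter P? (ks ++ rest)))                      ≡⟨ ≡.cong (sum ∘ map 𝟙) (List.filter-++ P? ks rest) ⟩
        sum (map 𝟙 (filter P? ks ++ filter P? rest))              ≡⟨ ≡.cong sum (List.map-++ 𝟙 (filter P? ks) _) ⟩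
        sum (map 𝟙 (filter P? ks) ++ map 𝟙 (filter P? rest))      ≡⟨ sum-++ (map 𝟙 (filter P? ks)) _ ⟩
        sum (map 𝟙 (filter P? ks)) + sum (map 𝟙 (filter P? rest))
          ≡⟨ ≡.cong₂ _+_ (sum-inside _ (proj₁ ∘ ∈.∈-filter⁻ S P? P-resp {xs = ks}))
               (sum-outside _ (rest⇒∉ks ∘ proj₁ ∘ ∈.∈-filter⁻ S P? P-resp {xs = rest})) ⟩
        length (filter P? ks) + 0                                 ≡⟨ ℕ.+-identityʳ _ ⟩
        length (filter P? ks)                                     ∎)
        where
        open ≡.≡-Reasoning
        unique : UniqueSetoid.Unique T (attach (ks ++ rest))
        unique = Unique.map⁻ T S {f = proj₁} (λ e → e) (≡.subst Unique (≡.sym (map-proj₁-attach (ks ++ rest))) (Unique.filter⁺ S P? all!))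
        enumerates : Enumerates.IsEnumeration T (attach (ks ++ rest))
        enumerates (x , px) with ∈.∈-map⁻ T S
          (≡.subst (x ∈_) (≡.sym (map-proj₁-attach (ks ++ rest))) (∈.∈-filter⁺ S P? P-resp (all-enumerates x) px))
        ... | t , t∈ , x≈t = ∈.∈-resp-≈ T {x = t} {x , px} (sym x≈t) t∈

-- The complement of the blocking set as an arc.

module Construction {R : Ring c ℓ} {q : ℕ} (chain : Chain R q) where
  open Ring R hiding (zero; _+_; _*_)
  open Chain chain
  open Residues chain
  open Pseudolines chain
  open Lines chain
  open Geometry chain
  open Points chain
  open PHG R
  open RightModule R³ using (_≈ᴹ_; Carrierᴹ; ≈ᴹ-sym; ≈ᴹ-trans)
  open Counting points
  open Membership points using (_∈_)
  open UniqueSetoid points using (Unique)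

  pairs↔ : Fin (q * q) ↔ (Fin q × Fin q)
  pairs↔ = Fin.*↔×

  index↔ : Fin (q * q + q) ↔ Index
  index↔ = (pairs↔ ⊎-↔ ↔-id _) ↔-∘ Fin.+↔⊎ {q * q}

  blocker↔ : Fin (suc q * (q * q + q)) ↔ (Fin (suc q) × Index)
  blocker↔ = (↔-id _ ×-↔ index↔) ↔-∘ Fin.*↔× {suc q}

  code↔ : Fin (q * q * (q * q) + (q * q * q + q * q)) ↔ Code
  code↔ = (affine↔ ⊎-↔ ((slope↔ ⊎-↔ pairs↔) ↔-∘ Fin.+↔⊎ {q * q * q})) ↔-∘ Fin.+↔⊎ {q * q * (q * q)}
    where
    affine↔ = (pairs↔ ×-↔ pairs↔) ↔-∘ Fin.*↔× {q * q}
    slope↔  = (pairs↔ ×-↔ ↔-id _) ↔-∘ Fin.*↔× {q * q}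

  ∈𝓛⇒normal : ∀ i {v} → v ∈𝓛 i → Normal v
  ∈𝓛⇒normal i v∈ = go i (signature i v∈)
    where
    go : ∀ i {v} → Signature i v → Normal v
    go zero    (inj₁ (z≈1 , _))                    = affine z≈1
    go zero    (inj₂ (x≈1 , z∈ , _))               = slope x≈1 z∈
    go (suc _) (inj₁ (_ , inj₁ (z≈1 , _)))         = affine z≈1
    go (suc _) (inj₁ (_ , inj₂ (x≈1 , z∈ , _)))    = slope x≈1 z∈
    go (suc _) (inj₂ (_ , inj₁ (z≈1 , _)))         = affine z≈1
    go (suc j) (inj₂ (_ , inj₂ (y≈1 , z∈ , x≈)))   = vertical y≈1 (Rad-resp (sym x≈) (Rad-+ z∈ (Rad-j j))) z∈

  Blocker : Point → Set ℓ
  Blocker p = ∃ λ i → vec p ∈𝓛 i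

  blocker? : ∀ p → Dec (Blocker p)
  blocker? p = Dec.map′ (λ (k , e) → proj₁ (to k) , proj₂ (to k) , e)
    (λ (i , s , e) → from (i , s) , ≡.subst (λ (i , s) → 𝓛-vector i s ≈ᴹ vec p) (≡.sym (strictlyInverseˡ (i , s))) e)
    (Fin.any? λ k → 𝓛-vector (proj₁ (to k)) (proj₂ (to k)) ≈ᴹ? vec p)
    where open Inverse blocker↔

  blocker-resp : ∀ {p p′} → p ≈ᴾ p′ → Blocker p → Blocker p′
  blocker-resp {p} {p′} e (i , v∈) = i , ∈𝓛-resp {i} (vec-cong {p} {p′} e) v∈

  length-blockers : ∀ {xs} → Unique xs → (∀ {p} → p ∈ xs → Blocker p) → length xs ≤ suc q * (q * q + q)
  length-blockers xs! blockers = length≤ (λ p k → 𝓛-vector (proj₁ (to k)) (proj₂ (to k)) ≈ᴹ vec p)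
    (λ {p} {p′} {k} e e′ → vec-injective {p} {p′} (≈ᴹ-trans (≈ᴹ-sym e) e′)) xs!
    λ {p} p∈ → let i , s , e = blockers {p} p∈ in from (i , s) ,
      ≡.subst (λ (i , s) → 𝓛-vector i s ≈ᴹ vec p) (≡.sym (strictlyInverseˡ (i , s))) e
    where open Inverse blocker↔

  normalPoint : Code → Point
  normalPoint s = point (decode s) (decode-normal s)

  allPoints : List Point
  allPoints = tabulate (normalPoint ∘ Inverse.to code↔)

  allPoints-unique : Unique allPoints
  allPoints-unique = Unique.tabulate⁺ points {f = normalPoint ∘ to} λ {k} {k′} e → Injection.injective (↔⇒↣ code↔)
    (decode-injective (to k) (to k′) (≈ᴹ-trans (≈ᴹ-sym (vec-point _ _))
      (≈ᴹ-trans (vec-cong {normalPoint (to k)} {normalPoint (to k′)} e) (vec-point _ _))))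
    where open Inverse code↔

  allPoints-enumerates : Enumerates.IsEnumeration points allPoints
  allPoints-enumerates p = let s , e = decode-surjective (vec-normal p) in
    ∈.∈-resp-≈ points {x = normalPoint (to (from s))} {p}
      (vec-injective {normalPoint (to (from s))} {p} (≈ᴹ-trans (vec-point _ _)
        (≡.subst (λ t → decode t ≈ᴹ vec p) (≡.sym (strictlyInverseˡ s)) (≈ᴹ-sym e))))
      (∈.∈-tabulate⁺ points {f = normalPoint ∘ to} (from s))
    where open Inverse code↔

  unblocked : List Point
  unblocked = filter (Dec.¬? ∘ blocker?) allPoints

  length-unblocked : q ^ 4 ∸ q ^ 2 ∸ q ≤ length unblocked
  length-unblocked = begin
    q ^ 4 ∸ q ^ 2 ∸ q                                         ≡⟨ ℕ.∸-+-assoc (q ^ 4) (q ^ 2) q ⟩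
    -- Adding t = q³ + q² on both sides turns the two terms into the number of all points and the
    -- bound for the blocking set, leaving identities without subtraction.
    q ^ 4 ∸ (q ^ 2 + q)                                       ≡⟨ ℕ.[m+n]∸[m+o]≡n∸o t (q ^ 4) (q ^ 2 + q) ⟨
    t + q ^ 4 ∸ (t + (q ^ 2 + q))                             ≡⟨ ≡.cong₂ _∸_ (total q) (blocking q) ⟩
    q * q * (q * q) + (q * q * q + q * q) ∸ suc q * (q * q + q)
      ≡⟨ ≡.cong (_∸ suc q * (q * q + q)) (List.length-tabulate (normalPoint ∘ Inverse.to code↔)) ⟨
    length allPoints ∸ suc q * (q * q + q)
      ≡⟨ ≡.cong (_∸ suc q * (q * q + q)) (length-filter-¬ blocker? allPoints) ⟨
    length blocked + length unblocked ∸ suc q * (q * q + q)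
      ≤⟨ ℕ.∸-monoʳ-≤ (length blocked + length unblocked) blocked≤ ⟩
    length blocked + length unblocked ∸ length blocked        ≡⟨ ℕ.m+n∸m≡n (length blocked) (length unblocked) ⟩
    length unblocked                                          ∎
    where
    open ℕ.≤-Reasoning
    t = q * q * q + q * q
    blocked = filter blocker? allPoints
    blocked≤ : length blocked ≤ suc q * (q * q + q)
    blocked≤ = length-blockers (Unique.filter⁺ points blocker? allPoints-unique)
      (proj₂ ∘ ∈.∈-filter⁻ points blocker? (λ {p} {p′} → blocker-resp {p} {p′}) {xs = allPoints})
    total : ∀ q → q * q * q + q * q + q * (q * (q * (q * 1))) ≡ q * q * (q * q) + (q * q * q + q * q)
    total = solve-∀
    blocking : ∀ q → q * q * q + q * q + (q * (q * 1) + q) ≡ suc q * (q * q + q)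
    blocking = solve-∀

  -- The blocking set is only bounded from above, so its complement may be too
  -- large; every part of the complement satisfies the condition on lines.
  arcPoints : List Point
  arcPoints = take (q ^ 4 ∸ q ^ 2 ∸ q) unblocked

  length-arcPoints : length arcPoints ≡ q ^ 4 ∸ q ^ 2 ∸ q
  length-arcPoints = ≡.trans (List.length-take _ unblocked) (ℕ.m≤n⇒m⊓n≡m length-unblocked)

  arcPoints-unique : Unique arcPoints
  arcPoints-unique = Unique.take⁺ points (q ^ 4 ∸ q ^ 2 ∸ q) (Unique.filter⁺ points _ allPoints-unique)

  ∈-take : ∀ n {xs : List Point} {p} → p ∈ take n xs → p ∈ xs
  ∈-take (suc n) {_ ∷ _} {p} (here e)   = here e
  ∈-take (suc n) {_ ∷ _} {p} (there p∈) = there (∈-take n {p = p} p∈)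

  arcPoints-unblocked : ∀ {p} → p ∈ arcPoints → ¬ Blocker p
  arcPoints-unblocked {p} p∈ = proj₂ (∈.∈-filter⁻ points (Dec.¬? ∘ blocker?)
    (λ {p} {p′} e p∉ p′∈ → p∉ (blocker-resp {p′} {p} (Setoid.sym points {p} {p′} e) p′∈))
    {v = p} {xs = allPoints} (∈-take _ {p = p} p∈))

  record Blockers (L : Carrierᴹ → Set ℓ) : Set (c ⊔ ℓ) where
    field
      vector    : Fin (suc q) → Carrierᴹ
      on        : ∀ k → L (vector k)
      in𝓛       : ∀ k → ∃ λ i → vector k ∈𝓛 i
      injective : ∀ {k k′} → vector k ≈ᴹ vector k′ → k ≡ k′

  -- Disjointness of the pseudolines makes the q + 1 points distinct: one from each pseudoline, or a
  -- segment and a point of another pseudoline.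
  blockers : ∀ {L} → Blocked L → Blockers L
  blockers (transversal meets) = record
    { vector = λ i → Extra.point (meets i)
    ; on = λ i → Extra.on (meets i)
    ; in𝓛 = λ i → i , Extra.in𝓛 (meets i)
    ; injective = λ {i} {i′} e → 𝓛-disjoint {i} (∈𝓛-resp {i} e (Extra.in𝓛 (meets i))) (Extra.in𝓛 (meets i′))
    }
  blockers {L} (contains {i} {i′} i≢i′ x s) = record
    { vector = vector ; on = on ; in𝓛 = in𝓛 ; injective = λ {k} {k′} → injective k k′ }
    where
    vector : Fin (suc q) → Carrierᴹ
    vector zero    = Extra.point x
    vector (suc d) = Segment.point s d
    on : ∀ k → L (vector k)
    on zero    = Extra.on x
    on (suc d) = Segment.on s d
    in𝓛 : ∀ k → ∃ λ i → vector k ∈𝓛 i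
    in𝓛 zero    = i , Extra.in𝓛 x
    in𝓛 (suc d) = i′ , Segment.in𝓛 s d
    injective : ∀ k k′ → vector k ≈ᴹ vector k′ → k ≡ k′
    injective zero    zero     _ = ≡.refl
    injective zero    (suc d)  e = ⊥-elim (i≢i′ (𝓛-disjoint {i} {i′} (∈𝓛-resp {i} e (Extra.in𝓛 x)) (Segment.in𝓛 s d)))
    injective (suc d) zero     e = ⊥-elim (i≢i′ (𝓛-disjoint {i} {i′} (Extra.in𝓛 x) (∈𝓛-resp {i′} e (Segment.in𝓛 s d))))
    injective (suc d) (suc d′) e = ≡.cong suc (Segment.injective s e)

  record LineData (N : Submodule R³) : Set (lsuc (c ⊔ ℓ)) where
    field
      On         : Carrierᴹ → Set ℓ
      mem⇒on     : ∀ {v} → mem N v → On v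
      on⇒mem     : ∀ {v} → On v → mem N v
      blocked    : Blocked On
      covered    : Covered On

  lineData : ∀ N → Equation N → LineData N
  lineData N (oblique m b to from) = record
    { On = Oblique.On m b ; mem⇒on = to ; on⇒mem = from
    ; blocked = Oblique.blocked m b ; covered = covered-oblique m b }
  lineData N (steep k b k∈ to from) = record
    { On = Steep.On k b k∈ ; mem⇒on = to ; on⇒mem = from
    ; blocked = Steep.blocked k b k∈ ; covered = covered-steep k b k∈ }
  lineData N (infinite k l k∈ l∈ to from) = record
    { On = Infinite.On k l k∈ l∈ ; mem⇒on = to ; on⇒mem = from
    ; blocked = Infinite.blocked k l k∈ l∈ ; covered = covered-infinite k l k∈ l∈ }

  on-resp : ∀ (L : Line) {p p′} → p ≈ᴾ p′ → p on L → p′ on L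
  on-resp L (_ , ⊇) p⊆ x∈ = p⊆ (⊇ x∈)

  module _ (L : Line) (line : LineData (proj₁ L)) (block : Blockers (LineData.On line)) where
    open LineData line
    open Blockers block renaming (on to vector-on)
    open Covered covered
    private
      onL? : ∀ p → Dec (p on L)
      onL? p = on? p L

      onL-resp : ∀ {p p′} → p ≈ᴾ p′ → p on L → p′ on L
      onL-resp {p} {p′} e = on-resp L {p} {p′} e

      vector-normal : ∀ k → Normal (vector k)
      vector-normal k = ∈𝓛⇒normal (proj₁ (in𝓛 k)) (proj₂ (in𝓛 k))

      blockPoint : Fin (suc q) → Point
      blockPoint k = point (vector k) (vector-normal k)

      vec-blockPoint : ∀ k → vec (blockPoint k) ≈ᴹ vector k
      vec-blockPoint k = vec-point (vector k) (vector-normal k)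

      kept placed : List Point
      kept = filter onL? arcPoints
      placed = tabulate blockPoint

      kept⇒ : ∀ {p} → p ∈ kept → p ∈ arcPoints × p on L
      kept⇒ {p} = ∈.∈-filter⁻ points onL? (λ {p} {p′} → onL-resp {p} {p′}) {v = p} {xs = arcPoints}

      blocker-point : ∀ k → Blocker (blockPoint k)
      blocker-point k = let i , v∈ = in𝓛 k in i , ∈𝓛-resp {i} (≈ᴹ-sym (vec-blockPoint k)) v∈

      disjoint : ∀ {p} → p ∈ kept × p ∈ placed → ⊥
      disjoint {p} (p∈kept , p∈placed) = let k , e = ∈.∈-tabulate⁻ points {f = blockPoint} {v = p} p∈placed in
        arcPoints-unblocked {p} (proj₁ (kept⇒ {p} p∈kept))
          (blocker-resp {blockPoint k} {p} (Setoid.sym points {p} {blockPoint k} e) (blocker-point k))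

      both-unique : Unique (kept ++ placed)
      both-unique = Unique.++⁺ points (Unique.filter⁺ points onL? arcPoints-unique)
        (Unique.tabulate⁺ points {f = blockPoint} λ {k} {k′} e → injective (≈ᴹ-trans (≈ᴹ-sym (vec-blockPoint k))
          (≈ᴹ-trans (vec-cong {blockPoint k} {blockPoint k′} e) (vec-blockPoint k′))))
        (λ {p} → disjoint {p})

      vec-on : ∀ {p} → p ∈ kept ++ placed → mem (proj₁ L) (vec p)
      vec-on {p} p∈ = go (∈.∈-++⁻ points {v = p} kept {placed} p∈)
        where
        go : p ∈ kept ⊎ p ∈ placed → mem (proj₁ L) (vec p)
        go (inj₁ p∈kept)   = proj₂ (kept⇒ {p} p∈kept) (vec-inside p)
        go (inj₂ p∈placed) = let k , e = ∈.∈-tabulate⁻ points {f = blockPoint} {v = p} p∈placed in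
          Submodule.resp (proj₁ L)
            (≈ᴹ-trans (≈ᴹ-sym (vec-blockPoint k)) (≈ᴹ-sym (vec-cong {p} {blockPoint k} e)))
            (on⇒mem (vector-on k))

      both≤ : length (kept ++ placed) ≤ q * q + q
      both≤ = length≤ (λ p k → vec p ≈ᴹ cover (Inverse.to index↔ k))
        (λ {p} {p′} e e′ → vec-injective {p} {p′} (≈ᴹ-trans e (≈ᴹ-sym e′))) both-unique
        λ {p} p∈ → let s , e = covers (vec-normal p) (mem⇒on (vec-on {p} p∈)) in
          Inverse.from index↔ s , ≡.subst (λ t → vec p ≈ᴹ cover t) (≡.sym (Inverse.strictlyInverseˡ index↔ s)) e

    -- The arc points on the line and its q + 1 blocking points are distinct and together number at
    -- most q² + q.
    arc-on-line : length (filter onL? arcPoints) ≤ q ^ 2 ∸ 1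
    arc-on-line = ℕ.m+n≤o⇒m≤o∸n (length kept) (ℕ.+-cancelʳ-≤ q _ _ (begin
      length kept + 1 + q                ≡⟨ ℕ.+-assoc (length kept) 1 q ⟩
      length kept + suc q                ≡⟨ ≡.cong (length kept +_) (List.length-tabulate blockPoint) ⟨
      length kept + length placed        ≡⟨ List.length-++ kept ⟨
      length (kept ++ placed)            ≤⟨ both≤ ⟩
      q * q + q                          ≡⟨ ≡.cong (λ n → q * n + q) (ℕ.*-identityʳ q) ⟨
      q ^ 2 + q                          ∎))
      where open ℕ.≤-Reasoning

  lineOf : ∀ (L : Line) → LineData (proj₁ L)
  lineOf (N , free) = lineData N (equation N free)

  open Subset _≟ᴾ_ allPoints-enumerates allPoints-unique arcPoints arcPoints-unique

  arc : ProjectiveArc (q ^ 4 ∸ q ^ 2 ∸ q) (q ^ 2 ∸ 1)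
  arc = indicator , record
    { total = ≡.subst (SumsTo points indicator) length-arcPoints sumsTo
    ; lines = λ L → length (filter (λ p → on? p L) arcPoints) ,
        sumsTo-sub (λ p → on? p L) (λ {p} {p′} → on-resp L {p} {p′}) (restrict indicator L) (λ _ → ≡.refl) ,
        arc-on-line L (lineOf L) (blockers (LineData.blocked (lineOf L)))
    } , indicator-0∨1

-- The two forms of the bound, under truncated subtraction.

arc-size : ∀ q → q * (q + 1) * (q ^ 2 ∸ 1) ∸ q ^ 3 ≡ q ^ 4 ∸ q ^ 2 ∸ q
arc-size q = begin
  q * (q + 1) * (q ^ 2 ∸ 1) ∸ q ^ 3
    ≡⟨ ≡.cong (_∸ q ^ 3) (ℕ.*-distribˡ-∸ (q * (q + 1)) (q ^ 2) 1) ⟩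
  q * (q + 1) * q ^ 2 ∸ q * (q + 1) * 1 ∸ q ^ 3
    ≡⟨ ℕ.∸-+-assoc (q * (q + 1) * q ^ 2) (q * (q + 1) * 1) (q ^ 3) ⟩
  q * (q + 1) * q ^ 2 ∸ (q * (q + 1) * 1 + q ^ 3)
    ≡⟨ ≡.cong₂ _∸_ (expand₁ q) (expand₂ q) ⟩
  q ^ 3 + q ^ 4 ∸ (q ^ 3 + (q ^ 2 + q))
    ≡⟨ ℕ.[m+n]∸[m+o]≡n∸o (q ^ 3) (q ^ 4) _ ⟩
  q ^ 4 ∸ (q ^ 2 + q)
    ≡⟨ ℕ.∸-+-assoc (q ^ 4) (q ^ 2) q ⟨
  q ^ 4 ∸ q ^ 2 ∸ q ∎
  where
  open ≡.≡-Reasoning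
  expand₁ : ∀ q → q * (q + 1) * (q * (q * 1)) ≡ q * (q * (q * 1)) + q * (q * (q * (q * 1)))
  expand₁ = solve-∀
  expand₂ : ∀ q → q * (q + 1) * 1 + q * (q * (q * 1)) ≡ q * (q * (q * 1)) + (q * (q * 1) + q)
  expand₂ = solve-∀

theorem3p1 : ∀ {c ℓ f ℓ₁ ℓ₂ : Level} (R : Ring c ℓ) (F : HeytingField f ℓ₁ ℓ₂) (q : ℕ) →
    IsFiniteChainRingOfLength2 R →
    IsGaloisField F q →
    HasResidueField R F →
    PHG.ProjectiveArc R (q ^ 4 ∸ q ^ 2 ∸ q) (q ^ 2 ∸ 1)
    × (∀ m → PHG.Is-m R (q ^ 2 ∸ 1) m → q * (q + 1) * (q ^ 2 ∸ 1) ∸ q ^ 3 ≤ m)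
    × q * (q + 1) * (q ^ 2 ∸ 1) ∸ q ^ 3 ≡ q ^ 4 ∸ q ^ 2 ∸ q
theorem3p1 R F q isChain galois residue =
  arc ,
  (λ m is-m → ≡.subst (_≤ m) (≡.sym (arc-size q)) (PHG.Is-m.largest is-m _ arc)) ,
  arc-size q
  where open Construction (toChain R F q isChain galois residue) using (arc)
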